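{- Let $\ell\ge 3$. A partition is an $(\ell,0)$-JM partition if and only if it is a generalized $\ell$-partition.
   Context: $(x,y)$ denotes the box in row $x$ and column $y$ of a Young diagram. The hook length $h^\lambda_{(a,b)}$ is the number of boxes of $\lambda$ to the right of and below $(a,b)$ (same row or same column), including $(a,b)$. A partition $\lambda$ is an $(\ell,0)$-JM partition if there do not exist boxes $(a,b),(a,y),(x,b)$ in the Young diagram of $\lambda$ with $\ell\mid h^\lambda_{(a,b)}$, $\ell\nmid h^\lambda_{(a,y)}$ and $\ell\nmid h^\lambda_{(x,b)}$. A removable $\ell$-rim hook (for short, $\ell$-rim hook) of $\lambda$ is a connected sequence of $\ell$ boxes of the Young diagram of $\lambda$, containing no $2\times2$ square, whose removal from $\lambda$ leaves the Young diagram of a partition. It is horizontal (vertical) if it is contained in a single row (column). Two rim hooks are adjacent if there are boxes, one in each, which share an edge. A partition $\lambda$ is a generalized $\ell$-partition if: (1) it has no removable $\ell$-rim hooks other than horizontal and vertical ones; (2) if $R$ is a vertical (resp. horizontal) $\ell$-rim hook of $\lambda$ and $S$ is a horizontal (resp. vertical) $\ell$-rim hook of $\lambda\setminus R$, then $R$ and $S$ are not adjacent; (3) after removing any sequence of horizontal and vertical $\ell$-rim hooks from $\lambda$, the remaining partition satisfies (1) and (2). -}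

module Defs where

open import Data.List using (List; []; _∷_; length; filter; concatMap; map; upTo)
open import Data.List.Membership.Propositional using (_∈_; _∉_)
open import Data.List.Relation.Unary.All using (All)
open import Data.List.Relation.Unary.Linked using (Linked)
open import Data.List.Relation.Unary.Unique.Propositional using (Unique)
open import Data.Nat using (ℕ; zero; suc; _≤_; _<_; _≥_; _≟_; _≤?_)
open import Data.Nat.Divisibility using (_∣_; _∤_)
open import Data.Product using (∃-syntax; _×_; _,_; proj₁; proj₂)
open import Data.Sum using (_⊎_)
open import Function.Bundles using (_⇔_)
open import Relation.Binary.Construct.Closure.ReflexiveTransitive using (Star)
open import Relation.Binary.PropositionalEquality using (_≡_)
open import Relation.Nullary using (¬_; Dec; _×-dec_; _⊎-dec_)

record Partition : Set where
  constructor mkPartition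
  field
    parts      : List ℕ
    positive   : All (0 <_) parts
    decreasing : Linked _≥_ parts

open Partition public

-- (x , y) is the box in row x and column y; rows and columns are counted from 0.
Box : Set
Box = ℕ × ℕ

nthPart : List ℕ → ℕ → ℕ
nthPart []       _       = 0
nthPart (p ∷ _)  zero    = p
nthPart (_ ∷ ps) (suc x) = nthPart ps x

rowLength : Partition → ℕ → ℕ
rowLength μ = nthPart (parts μ)

infix 4 _∈Y_

_∈Y_ : Box → Partition → Set
(x , y) ∈Y μ = y < rowLength μ x

-- The boxes of the Young diagram, each listed exactly once.
boxesOf : Partition → List Box
boxesOf μ = concatMap (λ x → map (x ,_) (upTo (rowLength μ x))) (upTo (length (parts μ)))

InHook : Box → Box → Set
InHook (a , b) (x , y) = (x ≡ a × b ≤ y) ⊎ (y ≡ b × a ≤ x)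

inHook? : ∀ c d → Dec (InHook c d)
inHook? (a , b) (x , y) = (x ≟ a ×-dec b ≤? y) ⊎-dec (y ≟ b ×-dec a ≤? x)

hookLength : Partition → Box → ℕ
hookLength μ c = length (filter (inHook? c) (boxesOf μ))

IsJM : ℕ → Partition → Set
IsJM ℓ μ = ¬ (∃[ a ] ∃[ b ] ∃[ x ] ∃[ y ]
  ( (a , b) ∈Y μ × (a , y) ∈Y μ × (x , b) ∈Y μ
  × ℓ ∣ hookLength μ (a , b)
  × ℓ ∤ hookLength μ (a , y)
  × ℓ ∤ hookLength μ (x , b) ))

data ShareEdge : Box → Box → Set where
  right : ∀ {x y} → ShareEdge (x , y) (x , suc y)
  left  : ∀ {x y} → ShareEdge (x , suc y) (x , y)
  below : ∀ {x y} → ShareEdge (x , y) (suc x , y)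
  above : ∀ {x y} → ShareEdge (suc x , y) (x , y)

StepIn : List Box → Box → Box → Set
StepIn R c d = c ∈ R × d ∈ R × ShareEdge c d

Connected : List Box → Set
Connected R = ∀ {c d} → c ∈ R → d ∈ R → Star (StepIn R) c d

Contains2×2 : List Box → Set
Contains2×2 R = ∃[ x ] ∃[ y ]
  ((x , y) ∈ R × (x , suc y) ∈ R × (suc x , y) ∈ R × (suc x , suc y) ∈ R)

-- A removable ℓ-rim hook of μ. The set of its boxes is given by a duplicate-free
-- list, whose order is irrelevant; `remaining` is the partition μ ∖ R, which is
-- determined by the boxes.
record RimHook (ℓ : ℕ) (μ : Partition) : Set where
  field
    boxes     : List Box
    unique    : Unique boxes
    size      : length boxes ≡ ℓ
    inside    : All (_∈Y μ) boxes
    connected : Connected boxes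
    no2×2     : ¬ Contains2×2 boxes
    remaining : Partition
    removal   : ∀ c → c ∈Y remaining ⇔ (c ∈Y μ × c ∉ boxes)

open RimHook public

module _ {ℓ : ℕ} {μ : Partition} where

  Horizontal : RimHook ℓ μ → Set
  Horizontal R = ∃[ x ] All (λ c → proj₁ c ≡ x) (boxes R)

  Vertical : RimHook ℓ μ → Set
  Vertical R = ∃[ y ] All (λ c → proj₂ c ≡ y) (boxes R)

AdjacentHooks : ∀ {ℓ μ ν} → RimHook ℓ μ → RimHook ℓ ν → Set
AdjacentHooks R S = ∃[ c ] ∃[ d ] (c ∈ boxes R × d ∈ boxes S × ShareEdge c d)

OnlyStraightHooks : ℕ → Partition → Set
OnlyStraightHooks ℓ μ = (R : RimHook ℓ μ) → Horizontal R ⊎ Vertical R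

NoAdjacentMixedHooks : ℕ → Partition → Set
NoAdjacentMixedHooks ℓ μ =
  (R : RimHook ℓ μ) (S : RimHook ℓ (remaining R)) →
  (Vertical R × Horizontal S) ⊎ (Horizontal R × Vertical S) →
  ¬ AdjacentHooks R S

data RemoveStraight (ℓ : ℕ) (μ : Partition) : Partition → Set where
  remove : (R : RimHook ℓ μ) → Horizontal R ⊎ Vertical R →
           RemoveStraight ℓ μ (remaining R)

record IsGeneralized (ℓ : ℕ) (μ : Partition) : Set where
  field
    onlyStraight    : OnlyStraightHooks ℓ μ
    noAdjacentMixed : NoAdjacentMixedHooks ℓ μ
    afterRemovals   : ∀ {ν} → Star (RemoveStraight ℓ) μ ν →
                      OnlyStraightHooks ℓ ν × NoAdjacentMixedHooks ℓ ν

{-# OPTIONS --safe #-}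
module Submission where

-- Encode a partition by its boundary path, read as an abacus: a row is a bead, a column a
-- gap, and the hook length at a box is the distance from the gap of its column to the bead
-- of its row. A bad configuration for the JM condition is then a bead r above a gap c on
-- the same runner together with a gap below r and a bead above c on other runners.
-- Removing an ℓ-rim hook moves a bead one place down its runner; the hook is vertical
-- (horizontal) iff the positions jumped over are all beads (gaps).
--
-- Such a move never creates a bad configuration, while a hook that is not straight, or two
-- adjacent hooks of different directions, exhibit one; so JM partitions are generalized.
-- Conversely, in a generalized partition with a bad configuration, some move leads to a
-- smaller generalized partition with a bad configuration, which is absurd by induction.

open import Defs
open import Data.Empty using (⊥; ⊥-elim)
open import Data.List using (List; []; _∷_; _++_; length; filter; map; upTo; applyUpTo)
import Data.List.Membership.DecPropositional as DecMembership
open import Data.List.Membership.Propositional using (_∈_; _∉_)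
open import Data.List.Membership.Propositional.Properties
open import Data.List.Properties using (length-++; length-applyUpTo)
open import Data.List.Relation.Unary.All as All using ()
import Data.List.Relation.Unary.All.Properties as All
open import Data.List.Relation.Unary.AllPairs as AllPairs using (_∷_)
import Data.List.Relation.Unary.AllPairs.Properties as AllPairs
open import Data.List.Relation.Unary.Any using (here; there)
open import Data.List.Relation.Unary.Linked using (Linked; []; [-]; _∷_)
import Data.List.Relation.Unary.Linked.Properties as Linked
open import Data.List.Relation.Unary.Unique.Propositional using (Unique)
import Data.List.Relation.Unary.Unique.Propositional.Properties as Unique
open import Data.Nat hiding (compare)
open import Data.Nat.Divisibility using (_∣_; divides)
open import Data.Nat.DivMod
open import Data.Nat.Induction using (<-wellFounded)
open import Data.Nat.Properties
open import Data.List.Extrema ≤-totalOrder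
  using (argmin; argmax; argmin-all; argmax-all; f[argmin]≤f[xs]; f[xs]≤f[argmax])
open import Data.Nat.Tactic.RingSolver using (solve-∀)
open import Data.Product using (∃-syntax; _×_; _,_; proj₁; proj₂; swap)
open import Data.Product.Properties using (≡-dec)
open import Data.Sum as Sum using (_⊎_; inj₁; inj₂; [_,_]′)
open import Function.Base using (_∘_; id; flip; case_of_)
open import Function.Bundles using (_⇔_; mk⇔; Equivalence)
open import Induction.WellFounded using (Acc; acc)
open import Relation.Binary.Construct.Closure.ReflexiveTransitive as Star using (Star; ε; _◅_)
import Relation.Binary.Construct.Flip.EqAndOrd as Flip
open import Relation.Binary.Definitions using (tri<; tri≈; tri>)
open import Relation.Binary.PropositionalEquality
  using (_≡_; _≢_; refl; sym; trans; cong; cong₂; subst; module ≡-Reasoning)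
open import Relation.Binary.Structures using (IsStrictTotalOrder)
open import Relation.Nullary using (¬_; Dec; yes; no; contradiction; _×-dec_; ¬?)
open import Relation.Unary using (Decidable)

open DecMembership (≡-dec _≟_ _≟_) using (_∈?_)

-- A violation in a generalized partition need not be visible as a forbidden hook of that partition:
-- `c` and `r` may be many steps apart, and `g` and `b` lie on other runners. The converse therefore
-- makes a single move and leaves the moved abacus to induction. The work is to find, for every
-- position of the four witnesses, a move after which some violation survives. Condition (2) is
-- called on directly only for two short patterns, each made of two consecutive steps on one runner.
-- The hypothesis `ℓ ≥ 3` is felt where `c ↑ r` with only beads between them. Moving `r` to `c`
-- would then destroy the violation, so the move is made on the runner of `g`. It may take away one
-- of the beads between `c` and `r`, and a second one has to serve as `b`.

-- The positions of an abacus; p ↑ q says that q is the next position after p on the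
-- same runner. The axioms are invariant under reversal of the order, which is how
-- conjugation of partitions enters.
record Runners : Set₁ where
  infix 4 _≺_ _↑_ _~_
  field
    Pos         : Set
    _≺_ _↑_ _~_ : Pos → Pos → Set
    isSTO       : IsStrictTotalOrder _≡_ _≺_
    ~-refl      : ∀ {p} → p ~ p
    ~-sym       : ∀ {p q} → p ~ q → q ~ p
    ~-trans     : ∀ {p q r} → p ~ q → q ~ r → p ~ r
    ↑⇒≺         : ∀ {p q} → p ↑ q → p ≺ q
    ↑⇒~         : ∀ {p q} → p ↑ q → p ~ q
    chain       : ∀ {p q} → p ≺ q → p ~ q → Star _↑_ p q
    off-runner  : ∀ {p q t} → p ↑ q → p ≺ t → t ≺ q → ¬ t ~ p
    represent   : ∀ {p q g} → p ↑ q → ¬ g ~ p → ∃[ t ] p ≺ t × t ≺ q × t ~ g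
    two-between : ∀ {p q} → p ↑ q → ∃[ t ] ∃[ u ] t ≢ u × (p ≺ t × t ≺ q) × (p ≺ u × u ≺ q)

reversed : Runners → Runners
reversed ℛ = record
  { Pos         = Pos
  ; _≺_         = flip _≺_
  ; _↑_         = flip _↑_
  ; _~_         = _~_
  ; isSTO       = Flip.isStrictTotalOrder isSTO
  ; ~-refl      = ~-refl
  ; ~-sym       = ~-sym
  ; ~-trans     = ~-trans
  ; ↑⇒≺         = ↑⇒≺
  ; ↑⇒~         = ~-sym ∘ ↑⇒~
  ; chain       = λ q≺p p~q → Star.reverse id (chain q≺p (~-sym p~q))
  ; off-runner  = λ q↑p t≺p q≺t t~p → off-runner q↑p q≺t t≺p (~-trans t~p (~-sym (↑⇒~ q↑p)))
  ; represent   = λ q↑p g≁p →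
      let t , q≺t , t≺p , t~g = represent q↑p (λ g~q → g≁p (~-trans g~q (↑⇒~ q↑p)))
      in t , t≺p , q≺t , t~g
  ; two-between = λ q↑p → let t , u , t≢u , i , j = two-between q↑p in t , u , t≢u , swap i , swap j
  }
  where open Runners ℛ

-- Abaci, violations and moves.

module Abacus (ℛ : Runners) where
  open Runners ℛ public
  open IsStrictTotalOrder isSTO using (compare; irrefl) renaming (trans to ≺-trans; _≟_ to _≟ᴾ_)

  infix 4 _⊰_
  _⊰_ : Pos → Pos → Set
  p ⊰ q = p ≺ q ⊎ p ≡ q

  ≺-⊰-trans : ∀ {p q r} → p ≺ q → q ⊰ r → p ≺ r
  ≺-⊰-trans p≺q (inj₁ q≺r) = ≺-trans p≺q q≺r
  ≺-⊰-trans p≺q (inj₂ refl) = p≺q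

  ⊰-≺-trans : ∀ {p q r} → p ⊰ q → q ≺ r → p ≺ r
  ⊰-≺-trans (inj₁ p≺q) q≺r = ≺-trans p≺q q≺r
  ⊰-≺-trans (inj₂ refl) q≺r = q≺r

  ≺⇒≢ : ∀ {p q} → p ≺ q → p ≢ q
  ≺⇒≢ p≺q refl = irrefl refl p≺q

  ↑*⇒~ : ∀ {p q} → Star _↑_ p q → p ~ q
  ↑*⇒~ ε        = ~-refl
  ↑*⇒~ (e ◅ es) = ~-trans (↑⇒~ e) (↑*⇒~ es)

  ↑*⇒⊰ : ∀ {p q} → Star _↑_ p q → p ⊰ q
  ↑*⇒⊰ ε        = inj₂ refl
  ↑*⇒⊰ (e ◅ es) = inj₁ (≺-⊰-trans (↑⇒≺ e) (↑*⇒⊰ es))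

  Between : Pos → Pos → Pos → Set
  Between p q t = p ≺ t × t ≺ q

  off-upper : ∀ {p q t} → p ↑ q → Between p q t → ¬ t ~ q
  off-upper p↑q (p≺t , t≺q) t~q = off-runner p↑q p≺t t≺q (~-trans t~q (~-sym (↑⇒~ p↑q)))

  record Config : Set₁ where
    field
      Bead Gap : Pos → Set
      cover    : ∀ p → Bead p ⊎ Gap p
      disjoint : ∀ {p} → Bead p → Gap p → ⊥

  AllBeads AllGaps : Config → Pos → Pos → Set
  AllBeads B p q = ∀ {t} → Between p q t → Config.Bead B t
  AllGaps  B p q = ∀ {t} → Between p q t → Config.Gap B t

  -- In a forbidden triple of boxes, `r` is the bead of the row and `c` the gap of the column of the
  -- corner box; `g` is the gap of the column of the second box and `b` the bead of the row of the
  -- third. The three order relations say that the boxes lie in the diagram.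
  record Violation (B : Config) : Set where
    open Config B
    field
      {r c g b} : Pos
      bead-r : Bead r
      gap-c  : Gap c
      gap-g  : Gap g
      bead-b : Bead b
      c≺r    : c ≺ r
      g≺r    : g ≺ r
      c≺b    : c ≺ b
      c~r    : c ~ r
      g≁r    : ¬ g ~ r
      b≁c    : ¬ b ~ c

  record Moved (p q : Pos) (B B′ : Config) : Set where
    open Config B
    open Config B′ using () renaming (Bead to Bead′; Gap to Gap′)
    field
      gap-p   : Gap p
      bead-q  : Bead q
      bead-p′ : Bead′ p
      gap-q′  : Gap′ q
      bead′   : ∀ {t} → Bead t → t ≢ q → Bead′ t
      gap′    : ∀ {t} → Gap t → t ≢ p → Gap′ t

    open Config B′ using () renaming (disjoint to disjoint′)

    bead⁻ : ∀ {t} → Bead′ t → t ≢ p → Bead t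
    bead⁻ {t} bead t≢p with cover t
    ... | inj₁ bt = bt
    ... | inj₂ gt = ⊥-elim (disjoint′ bead (gap′ gt t≢p))

    gap⁻ : ∀ {t} → Gap′ t → t ≢ q → Gap t
    gap⁻ {t} gap t≢q with cover t
    ... | inj₁ bt = ⊥-elim (disjoint′ (bead′ bt t≢q) gap)
    ... | inj₂ gt = gt

  module _ {B B′ : Config} {p q : Pos} (p↑q : p ↑ q) (move : Moved p q B B′) where
    open Config B
    open Config B′ using () renaming (Bead to Bead′; Gap to Gap′)
    open Moved move

    private
      bead-above : ∀ {t} → Bead′ t → ∃[ u ] Bead u × t ⊰ u × t ~ u
      bead-above {t} bead with t ≟ᴾ p
      ... | yes refl = q , bead-q , inj₁ (↑⇒≺ p↑q) , ↑⇒~ p↑q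
      ... | no t≢p   = t , bead⁻ bead t≢p , inj₂ refl , ~-refl

      gap-below : ∀ {t} → Gap′ t → ∃[ u ] Gap u × u ⊰ t × u ~ t
      gap-below {t} gap with t ≟ᴾ q
      ... | yes refl = p , gap-p , inj₁ (↑⇒≺ p↑q) , ↑⇒~ p↑q
      ... | no t≢q   = t , gap⁻ gap t≢q , inj₂ refl , ~-refl

    -- Undoing the move replaces the bead at `p` by the higher bead at `q`, and the gap at `q` by
    -- the lower gap at `p`, on the same runner. In a violation every bead lies above the gaps it is
    -- compared with, so all inequalities persist.
    violation⁻ : Violation B′ → Violation B
    violation⁻ v =
      let open Violation v
          r₁ , bead-r₁ , r⊰ , r~ = bead-above bead-r
          c₁ , gap-c₁  , c⊰ , c~ = gap-below gap-c
          g₁ , gap-g₁  , g⊰ , g~ = gap-below gap-g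
          b₁ , bead-b₁ , b⊰ , b~ = bead-above bead-b
      in record
        { bead-r = bead-r₁ ; gap-c = gap-c₁ ; gap-g = gap-g₁ ; bead-b = bead-b₁
        ; c≺r = ⊰-≺-trans c⊰ (≺-⊰-trans c≺r r⊰)
        ; g≺r = ⊰-≺-trans g⊰ (≺-⊰-trans g≺r r⊰)
        ; c≺b = ⊰-≺-trans c⊰ (≺-⊰-trans c≺b b⊰)
        ; c~r = ~-trans c~ (~-trans c~r r~)
        ; g≁r = λ g₁~r₁ → g≁r (~-trans (~-sym g~) (~-trans g₁~r₁ (~-sym r~)))
        ; b≁c = λ b₁~c₁ → b≁c (~-trans b~ (~-trans b₁~c₁ c~))
        }

  module _ {B : Config} where
    open Config B

    mixed⇒violation : ∀ {p q t u} → p ↑ q → Gap p → Bead q →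
                      Between p q t → Gap t → Between p q u → Bead u → Violation B
    mixed⇒violation p↑q gap-p bead-q t∈ gap-t u∈ bead-u = record
      { bead-r = bead-q ; gap-c = gap-p ; gap-g = gap-t ; bead-b = bead-u
      ; c≺r = ↑⇒≺ p↑q ; g≺r = proj₂ t∈ ; c≺b = proj₁ u∈
      ; c~r = ↑⇒~ p↑q
      ; g≁r = off-upper p↑q t∈
      ; b≁c = off-runner p↑q (proj₁ u∈) (proj₂ u∈)
      }

    uniform : ¬ Violation B → ∀ {p q} → p ↑ q → Gap p → Bead q →
              AllBeads B p q ⊎ AllGaps B p q
    uniform ¬v p↑q gap-p bead-q with two-between p↑q
    ... | t , _ , _ , t∈ , _ with cover t
    ...   | inj₁ bead-t = inj₁ λ {u} u∈ →
            [ id , (λ gap-u → ⊥-elim (¬v (mixed⇒violation p↑q gap-p bead-q u∈ gap-u t∈ bead-t))) ]′ (cover u)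
    ...   | inj₂ gap-t = inj₂ λ {u} u∈ →
            [ (λ bead-u → ⊥-elim (¬v (mixed⇒violation p↑q gap-p bead-q t∈ gap-t u∈ bead-u))) , id ]′ (cover u)

  -- If the two steps overlapped properly, `a` or `d` would be both a bead and a gap of `B′`. As the
  -- steps are not far apart either, they share an end: `d ≡ s` or `t ≡ a`. Together they form a
  -- double step on one runner, with a bead inside one half and a gap inside the other to serve as
  -- `b` and `g`.
  adjacent⇒violation : ∀ {B B′ B″ a s d t} → a ↑ s → Moved a s B B′ → d ↑ t → Moved d t B′ B″ →
    AllBeads B a s → AllGaps B′ d t → ¬ s ≺ d → ¬ t ≺ a → Violation B
  adjacent⇒violation {B} {B′} {_} {a} {s} {d} {t} a↑s move₁ d↑t move₂ beads gaps s⊀d t⊀a =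
    let u , _ , _ , u∈ , _ = two-between d↑t
        w , _ , _ , w∈ , _ = two-between a↑s
    in cases u u∈ w w∈
    where
    open Config B
    open Config B′ using () renaming (Bead to Bead′; Gap to Gap′; disjoint to disjoint′)
    open Moved move₁
    open Moved move₂ using () renaming (gap-p to gap-d′; bead-q to bead-t′)
    cases : ∀ u → Between d t u → ∀ w → Between a s w → Violation B
    cases u u∈ w w∈ with compare a d
    ... | tri≈ _ refl _ = ⊥-elim (disjoint′ bead-p′ gap-d′)
    ... | tri< a≺d _ _ with compare d s
    ...   | tri< d≺s _ _ = ⊥-elim (disjoint′ (bead′ (beads (a≺d , d≺s)) (≺⇒≢ d≺s)) gap-d′)
    ...   | tri> _ _ s≺d = ⊥-elim (s⊀d s≺d)
    ...   | tri≈ _ refl _ = record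
            { bead-r = bead⁻ bead-t′ (≺⇒≢ (≺-trans a≺d (↑⇒≺ d↑t)) ∘ sym)
            ; gap-c = gap-p
            ; gap-g = gap⁻ (gaps u∈) (≺⇒≢ (proj₁ u∈) ∘ sym)
            ; bead-b = beads w∈
            ; c≺r = ≺-trans a≺d (↑⇒≺ d↑t) ; g≺r = proj₂ u∈ ; c≺b = proj₁ w∈
            ; c~r = ~-trans (↑⇒~ a↑s) (↑⇒~ d↑t)
            ; g≁r = off-upper d↑t u∈
            ; b≁c = off-runner a↑s (proj₁ w∈) (proj₂ w∈)
            }
    cases u u∈ w w∈ | tri> _ _ d≺a with compare a t
    ...   | tri< a≺t _ _ = ⊥-elim (disjoint′ bead-p′ (gaps (d≺a , a≺t)))
    ...   | tri> _ _ t≺a = ⊥-elim (t⊀a t≺a)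
    ...   | tri≈ _ refl _ = record
            { bead-r = bead-q
            ; gap-c = gap⁻ gap-d′ (≺⇒≢ (≺-trans d≺a (↑⇒≺ a↑s)))
            ; gap-g = gap⁻ (gaps u∈) (≺⇒≢ (≺-trans (proj₂ u∈) (↑⇒≺ a↑s)))
            ; bead-b = beads w∈
            ; c≺r = ≺-trans d≺a (↑⇒≺ a↑s)
            ; g≺r = ≺-trans (proj₂ u∈) (↑⇒≺ a↑s)
            ; c≺b = ≺-trans d≺a (proj₁ w∈)
            ; c~r = ~-trans (↑⇒~ d↑t) (↑⇒~ a↑s)
            ; g≁r = λ u~s → off-upper d↑t u∈ (~-trans u~s (~-sym (↑⇒~ a↑s)))
            ; b≁c = λ w~d → off-runner a↑s (proj₁ w∈) (proj₂ w∈) (~-trans w~d (↑⇒~ d↑t))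
            }

  -- Tame abaci admit no violation.

  record Tame (B : Config) : Set₁ where
    open Config B
    field
      straight : ∀ {p q} → p ↑ q → Gap p → Bead q → AllBeads B p q ⊎ AllGaps B p q
      ¬bead-step : ∀ {p q r} → p ↑ q → q ↑ r → Gap p → AllBeads B p q → Bead q →
                   AllGaps B q r → Bead r → ⊥
      -- The mirror image of `¬bead-step`: reversal exchanges the two.
      ¬gap-step : ∀ {p q r} → p ↑ q → q ↑ r → Gap p → AllBeads B p q → Gap q →
                  AllGaps B q r → Bead r → ⊥
      -- The induction hypothesis, phrased without partitions so that it can be reversed too.
      next : ∀ {p q} → p ↑ q → Gap p → Bead q → ∃[ B′ ] Moved p q B B′ × ¬ Violation B′

  module _ {B : Config} where
    open Config B

    record Descent (c r : Pos) : Set where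
      field
        {p q} : Pos
        lower : Star _↑_ c p
        step  : p ↑ q
        upper : Star _↑_ q r
        gap-p : Gap p
        bead-q : Bead q

    -- The first bead met on the way up from `c` has a gap directly below it.
    descent : ∀ {c r} → Star _↑_ c r → Gap c → Bead r → Descent c r
    descent ε gap bead = ⊥-elim (disjoint bead gap)
    descent (_◅_ {j = m} e es) gap bead with cover m
    ... | inj₁ bead-m = record { lower = ε ; step = e ; upper = es ; gap-p = gap ; bead-q = bead-m }
    ... | inj₂ gap-m  = let open Descent (descent es gap-m bead)
                        in record { lower = e ◅ lower ; step = step ; upper = upper
                                  ; gap-p = gap-p ; bead-q = bead-q }

    module _ (tame : Tame B) (v : Violation B) where
      open Tame tame
      open Violation v

      private
        g≢ : ∀ {t} → t ~ r → g ≢ t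
        g≢ t~r refl = g≁r t~r

        b≢ : ∀ {t} → t ~ c → b ≢ t
        b≢ t~c refl = b≁c t~c

        -- With a bead at `t`, moving `q` down to `c` would leave a violation: the new gap at `q`
        -- takes the place of `c`, and `t` that of `b`.
        gap-above : ∀ {q t} → c ↑ q → Bead q → q ≺ r → q ≺ t → ¬ t ~ q → Gap t
        gap-above {q} {t} c↑q bead-q q≺r q≺t t≁q with cover t
        ... | inj₂ gap-t = gap-t
        ... | inj₁ bead-t =
          let _ , move , ¬v = next c↑q gap-c bead-q
              open Moved move using (bead′; gap′; gap-q′)
          in ⊥-elim (¬v record
            { bead-r = bead′ bead-r (≺⇒≢ q≺r ∘ sym)
            ; gap-c = gap-q′
            ; gap-g = gap′ gap-g (g≢ c~r)
            ; bead-b = bead′ bead-t (≺⇒≢ q≺t ∘ sym)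
            ; c≺r = q≺r ; g≺r = g≺r ; c≺b = q≺t
            ; c~r = ~-trans (~-sym (↑⇒~ c↑q)) c~r
            ; g≁r = g≁r ; b≁c = t≁q
            })

      -- The adjacent pair p ↑ q splits the runner between c and r. The moved abacus still
      -- violates the condition, with r, c replaced by p or q where they were moved, except
      -- when c = p and all beads above q lie on the runner (which leads to the excluded
      -- pattern or to another move above q), or when c ↑ r; then one moves on the runner of g.
      no-bead-descent : ∀ {p q} → Star _↑_ c p → p ↑ q → Star _↑_ q r →
                        Gap p → Bead q → AllBeads B p q → ⊥
      no-bead-descent {p} {q} lower@(e ◅ es) p↑q upper@(f ◅ fs) gap-p bead-q beads =
        let _ , move , ¬v = next p↑q gap-p bead-q
            open Moved move using (bead′; gap′)
            q≺r = ≺-⊰-trans (↑⇒≺ f) (↑*⇒⊰ fs)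
            c≺p = ≺-⊰-trans (↑⇒≺ e) (↑*⇒⊰ es)
        in ¬v record
          { bead-r = bead′ bead-r (≺⇒≢ q≺r ∘ sym)
          ; gap-c = gap′ gap-c (≺⇒≢ c≺p)
          ; gap-g = gap′ gap-g (g≢ (↑*⇒~ (p↑q ◅ upper)))
          ; bead-b = bead′ bead-b (b≢ (~-trans (~-sym (↑⇒~ p↑q)) (~-sym (↑*⇒~ lower))))
          ; c≺r = c≺r ; g≺r = g≺r ; c≺b = c≺b ; c~r = c~r ; g≁r = g≁r ; b≁c = b≁c
          }
      no-bead-descent {p} lower@(e ◅ es) p↑r ε gap-p _ beads =
        let _ , move , ¬v = next p↑r gap-p bead-r
            open Moved move using (bead-p′; bead′; gap′)
            t , _ , _ , t∈ , _ = two-between p↑r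
            c≺p = ≺-⊰-trans (↑⇒≺ e) (↑*⇒⊰ es)
        in ¬v record
          { bead-r = bead-p′
          ; gap-c = gap′ gap-c (≺⇒≢ c≺p)
          ; gap-g = gap′ gap-g (g≢ (↑⇒~ p↑r))
          ; bead-b = bead′ (beads t∈) (≺⇒≢ (proj₂ t∈))
          ; c≺r = c≺p
          ; g≺r = g≺p
          ; c≺b = ≺-trans c≺p (proj₁ t∈)
          ; c~r = ↑*⇒~ lower
          ; g≁r = λ g~p → g≁r (~-trans g~p (↑⇒~ p↑r))
          ; b≁c = λ t~c → off-runner p↑r (proj₁ t∈) (proj₂ t∈) (~-trans t~c (↑*⇒~ lower))
          }
        where
        g≺p : g ≺ p
        g≺p with compare g p
        ... | tri< g≺p _ _ = g≺p
        ... | tri≈ _ g≡p _ = ⊥-elim (g≢ (↑⇒~ p↑r) g≡p)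
        ... | tri> _ _ p≺g = ⊥-elim (disjoint (beads (p≺g , g≺r)) gap-g)
      no-bead-descent {q = q} ε c↑q (_◅_ {j = m} q↑m ms) _ bead-q beads with cover m
      ... | inj₁ bead-m =
        ¬bead-step c↑q q↑m gap-c beads bead-q
          (λ t∈ → gap-above c↑q bead-q (≺-⊰-trans (↑⇒≺ q↑m) (↑*⇒⊰ ms)) (proj₁ t∈)
                    (off-runner q↑m (proj₁ t∈) (proj₂ t∈)))
          bead-m
      ... | inj₂ gap-m =
        let open Descent (descent ms gap-m bead-r) using (lower)
              renaming (p to p₁; q to q₁; step to p₁↑q₁; gap-p to gap-p₁; bead-q to bead-q₁)
            _ , move , ¬v = next p₁↑q₁ gap-p₁ bead-q₁
            open Moved move using (bead-p′; bead′; gap′)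
            u , _ , _ , u∈ , _ = two-between q↑m
            w , _ , _ , w∈ , _ = two-between c↑q
            u≁q = off-runner q↑m (proj₁ u∈) (proj₂ u∈)
            gap-u = gap-above c↑q bead-q (≺-⊰-trans (↑⇒≺ q↑m) (↑*⇒⊰ ms)) (proj₁ u∈) u≁q
            w≁c = off-runner c↑q (proj₁ w∈) (proj₂ w∈)
            q≺p₁ = ≺-⊰-trans (↑⇒≺ q↑m) (↑*⇒⊰ lower)
            q~p₁ = ↑*⇒~ (q↑m ◅ lower)
            c≺p₁ = ≺-trans (↑⇒≺ c↑q) q≺p₁
            u≺p₁ = ≺-⊰-trans (proj₂ u∈) (↑*⇒⊰ lower)
            w≺q₁ = ≺-trans (proj₂ w∈) (≺-trans q≺p₁ (↑⇒≺ p₁↑q₁))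
        in ¬v record
          { bead-r = bead-p′
          ; gap-c = gap′ gap-c (≺⇒≢ c≺p₁)
          ; gap-g = gap′ gap-u (≺⇒≢ u≺p₁)
          ; bead-b = bead′ (beads w∈) (≺⇒≢ w≺q₁)
          ; c≺r = c≺p₁
          ; g≺r = u≺p₁
          ; c≺b = proj₁ w∈
          ; c~r = ~-trans (↑⇒~ c↑q) q~p₁
          ; g≁r = λ u~p₁ → u≁q (~-trans u~p₁ (~-sym q~p₁))
          ; b≁c = w≁c
          }
      no-bead-descent ε c↑r ε _ _ beads with represent c↑r (λ g~c → g≁r (~-trans g~c c~r))
      ... | t , c≺t , t≺r , t~g =
        let open Descent (descent (chain g≺t (~-sym t~g)) gap-g (beads (c≺t , t≺r)))
            _ , move , ¬v = next step gap-p bead-q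
            open Moved move using (bead′; gap′; gap-q′)
            g~p = ↑*⇒~ lower
            g~q = ~-trans g~p (↑⇒~ step)
            u , u∈ , u≢q = other q
        in ¬v record
          { bead-r = bead′ bead-r (λ r≡q → g≁r (subst (g ~_) (sym r≡q) g~q))
          ; gap-c = gap′ gap-c (λ c≡p → g≁r (~-trans (subst (g ~_) (sym c≡p) g~p) c~r))
          ; gap-g = gap-q′
          ; bead-b = bead′ (beads u∈) u≢q
          ; c≺r = c≺r
          ; g≺r = ⊰-≺-trans (↑*⇒⊰ upper) t≺r
          ; c≺b = proj₁ u∈
          ; c~r = c~r
          ; g≁r = λ q~r → g≁r (~-trans g~q q~r)
          ; b≁c = off-runner c↑r (proj₁ u∈) (proj₂ u∈)
          }
        where
        g≺t : g ≺ t
        g≺t with compare g c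
        ... | tri< g≺c _ _ = ≺-trans g≺c c≺t
        ... | tri≈ _ refl _ = ⊥-elim (g≁r c~r)
        ... | tri> _ _ c≺g = ⊥-elim (disjoint (beads (c≺g , g≺r)) gap-g)

        -- The move on the runner of `g` may take its bead from between `c` and `r`. Both positions
        -- of `two-between` are needed here, so that one bead stays.
        other : ∀ q → ∃[ u ] Between c r u × u ≢ q
        other q with two-between c↑r
        ... | u , w , u≢w , u∈ , w∈ with u ≟ᴾ q
        ...   | no u≢q = u , u∈ , u≢q
        ...   | yes refl = w , w∈ , u≢w ∘ sym

-- Conjugation: the order is reversed, beads and gaps are exchanged.

module _ {ℛ : Runners} where
  private
    module A = Abacus ℛ
    module D = Abacus (reversed ℛ)

  reversedConfig : A.Config → D.Config
  reversedConfig B = record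
    { Bead = Gap ; Gap = Bead ; cover = λ p → Sum.swap (cover p) ; disjoint = flip disjoint }
    where open A.Config B

  reversedViolation : ∀ {B} → A.Violation B → D.Violation (reversedConfig B)
  reversedViolation v = record
    { bead-r = gap-c ; gap-c = bead-r ; gap-g = bead-b ; bead-b = gap-g
    ; c≺r = c≺r ; g≺r = c≺b ; c≺b = g≺r ; c~r = A.~-sym c~r ; g≁r = b≁c ; b≁c = g≁r }
    where open A.Violation v

  reversedViolation⁻ : ∀ {B} → D.Violation (reversedConfig B) → A.Violation B
  reversedViolation⁻ v = record
    { bead-r = gap-c ; gap-c = bead-r ; gap-g = bead-b ; bead-b = gap-g
    ; c≺r = c≺r ; g≺r = c≺b ; c≺b = g≺r ; c~r = A.~-sym c~r ; g≁r = b≁c ; b≁c = g≁r }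
    where open D.Violation v

  reversedMoved : ∀ {p q B B′} → A.Moved p q B B′ → D.Moved q p (reversedConfig B) (reversedConfig B′)
  reversedMoved move = record
    { gap-p = bead-q ; bead-q = gap-p ; bead-p′ = gap-q′ ; gap-q′ = bead-p′ ; bead′ = gap′ ; gap′ = bead′ }
    where open A.Moved move

  reversedTame : ∀ {B} → A.Tame B → D.Tame (reversedConfig B)
  reversedTame tame = record
    { straight = λ q↑p bead gap → Sum.map (λ gaps {t} t∈ → gaps (swap t∈)) (λ beads {t} t∈ → beads (swap t∈))
                                    (Sum.swap (straight q↑p gap bead))
    ; ¬bead-step = λ q↑p r↑q bead-p gaps gap-q beads gap-r →
        ¬gap-step r↑q q↑p gap-r (beads ∘ swap) gap-q (gaps ∘ swap) bead-p
    ; ¬gap-step = λ q↑p r↑q bead-p gaps bead-q beads gap-r →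
        ¬bead-step r↑q q↑p gap-r (beads ∘ swap) bead-q (gaps ∘ swap) bead-p
    ; next = λ q↑p bead gap → let B′ , move , ¬v = next q↑p gap bead
                              in reversedConfig B′ , reversedMoved move , ¬v ∘ reversedViolation⁻
    }
    where open A.Tame tame

  -- By straightness, the step found by `descent` passes over beads only or over gaps only. The
  -- second case is the first one read in the reversed abacus, where `c` and `r` as well as `g` and
  -- `b` change places.
  tame⇒¬violation : ∀ {B} → A.Tame B → ¬ A.Violation B
  tame⇒¬violation {B} tame v with A.Tame.straight tame step gap-p bead-q
    where open A.Violation v
          open A.Descent (A.descent {B} (A.chain c≺r c~r) gap-c bead-r)
  ... | inj₁ beads = A.no-bead-descent tame v lower step upper gap-p bead-q beads
    where open A.Violation v
          open A.Descent (A.descent {B} (A.chain c≺r c~r) gap-c bead-r)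
  ... | inj₂ gaps = D.no-bead-descent (reversedTame tame) (reversedViolation v)
                      (Star.reverse id upper) step (Star.reverse id lower) bead-q gap-p (gaps ∘ swap)
    where open A.Violation v
          open A.Descent (A.descent {B} (A.chain c≺r c~r) gap-c bead-r)

  adjacent⇒violation′ : ∀ {B B′ B″ a s d t} → a A.↑ s → A.Moved a s B B′ → d A.↑ t → A.Moved d t B′ B″ →
    A.AllGaps B a s → A.AllBeads B′ d t → ¬ s A.≺ d → ¬ t A.≺ a → A.Violation B
  adjacent⇒violation′ {B} {B′} {B″} a↑s move₁ d↑t move₂ gaps beads s⊀d t⊀a =
    reversedViolation⁻ (D.adjacent⇒violation {reversedConfig B} {reversedConfig B′} {reversedConfig B″}
      a↑s (reversedMoved move₁) d↑t (reversedMoved move₂) (gaps ∘ swap) (beads ∘ swap) t⊀a s⊀d)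

-- Counting, and partitions described by their row lengths.

unique⊆⇒length≤ : {A : Set} {xs ys : List A} → Unique xs → (∀ {x} → x ∈ xs → x ∈ ys) → length xs ≤ length ys
unique⊆⇒length≤ {xs = []} _ _ = z≤n
unique⊆⇒length≤ {xs = x ∷ xs} (x∉xs ∷ uxs) xs⊆ys with ∈-∃++ (xs⊆ys (here refl))
... | as , bs , refl = begin
  suc (length xs)           ≤⟨ s≤s (unique⊆⇒length≤ uxs xs⊆as++bs) ⟩
  suc (length (as ++ bs))   ≡⟨ cong suc (length-++ as) ⟩
  suc (length as + length bs) ≡⟨ +-suc (length as) (length bs) ⟨
  length as + suc (length bs) ≡⟨ length-++ as ⟨
  length (as ++ x ∷ bs)     ∎
  where
  open ≤-Reasoning
  xs⊆as++bs : ∀ {y} → y ∈ xs → y ∈ as ++ bs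
  xs⊆as++bs y∈xs with ∈-++⁻ as (xs⊆ys (there y∈xs))
  ... | inj₁ y∈as = ∈-++⁺ˡ y∈as
  ... | inj₂ (here refl) = contradiction refl (All.lookup x∉xs y∈xs)
  ... | inj₂ (there y∈bs) = ∈-++⁺ʳ as y∈bs

unique-length : {A : Set} {xs ys : List A} → Unique xs → Unique ys →
                (∀ {x} → x ∈ xs → x ∈ ys) → (∀ {x} → x ∈ ys → x ∈ xs) → length xs ≡ length ys
unique-length uxs uys xs⊆ys ys⊆xs = ≤-antisym (unique⊆⇒length≤ uxs xs⊆ys) (unique⊆⇒length≤ uys ys⊆xs)

-- For `P` closed downwards this is the number whose predecessors are exactly the `a < n` with
-- `P a`. Column lengths, heights and the rows left by a removal are all defined in this way and are
-- then compared through their predecessors by `<⇒≤-pointwise`.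
threshold : {P : ℕ → Set} → Decidable P → ℕ → ℕ
threshold P? zero = 0
threshold P? (suc n) with P? 0
... | yes _ = suc (threshold (P? ∘ suc) n)
... | no _  = 0

threshold⁻ : {P : ℕ → Set} (P? : Decidable P) (n : ℕ) → ∀ {a} → a < threshold P? n → a < n × P a
threshold⁻ P? (suc n) a<t with P? 0
threshold⁻ P? (suc n) {zero} a<t | yes p = z<s , p
threshold⁻ P? (suc n) {suc a} a<t | yes p =
  let a<n , pa = threshold⁻ (P? ∘ suc) n (s<s⁻¹ a<t) in s<s a<n , pa

threshold⁺ : {P : ℕ → Set} (P? : Decidable P) → (∀ {a} → P (suc a) → P a) →
             ∀ {n a} → a < n → P a → a < threshold P? n
threshold⁺ {P} P? down {suc n} {a} a<n pa with P? 0
... | no ¬p = contradiction (to-zero a pa) ¬p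
  where
  to-zero : ∀ a → P a → P 0
  to-zero zero    = id
  to-zero (suc a) = to-zero a ∘ down
threshold⁺ P? down {suc n} {zero} a<n pa | yes _ = z<s
threshold⁺ P? down {suc n} {suc a} a<n pa | yes _ = s<s (threshold⁺ (P? ∘ suc) down (s<s⁻¹ a<n) pa)

<⇒≤-pointwise : ∀ {m n} → (∀ {a} → a < m → a < n) → m ≤ n
<⇒≤-pointwise f = ≮⇒≥ λ n<m → <-irrefl refl (f n<m)

nthPart-suc≤ : ∀ {ps} → Linked _≥_ ps → ∀ x → nthPart ps (suc x) ≤ nthPart ps x
nthPart-suc≤ []       x       = z≤n
nthPart-suc≤ [-]      x       = z≤n
nthPart-suc≤ (p ∷ _)  zero    = p
nthPart-suc≤ (_ ∷ ps) (suc x) = nthPart-suc≤ ps x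

nthPart-beyond : ∀ ps {x} → length ps ≤ x → nthPart ps x ≡ 0
nthPart-beyond []       _         = refl
nthPart-beyond (_ ∷ ps) (s≤s n≤x) = nthPart-beyond ps n≤x

nthPart-length : ∀ ps {x} → 0 < nthPart ps x → x < length ps
nthPart-length ps {x} 0<p with x <? length ps
... | yes x<n = x<n
... | no  x≮n = contradiction 0<p (<-irrefl (sym (nthPart-beyond ps (≮⇒≥ x≮n))))

rowLength-suc≤ : ∀ μ x → rowLength μ (suc x) ≤ rowLength μ x
rowLength-suc≤ μ = nthPart-suc≤ (decreasing μ)

antitone : {f : ℕ → ℕ} → (∀ x → f (suc x) ≤ f x) → ∀ {x x′} → x ≤ x′ → f x′ ≤ f x
antitone {f} step {x} {x′} x≤x′ = go (≤⇒≤′ x≤x′)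
  where
  go : ∀ {x′} → x ≤′ x′ → f x′ ≤ f x
  go ≤′-refl       = ≤-refl
  go (≤′-step x≤x′) = ≤-trans (step _) (go x≤x′)

rowLength-antitone : ∀ μ {x x′} → x ≤ x′ → rowLength μ x′ ≤ rowLength μ x
rowLength-antitone μ = antitone (rowLength-suc≤ μ)

∈Y-closed : ∀ μ {x y x′ y′} → x′ ≤ x → y′ ≤ y → (x , y) ∈Y μ → (x′ , y′) ∈Y μ
∈Y-closed μ x′≤x y′≤y y<λ = ≤-<-trans y′≤y (<-≤-trans y<λ (rowLength-antitone μ x′≤x))

row : Partition → ℕ → List Box
row μ x = map (x ,_) (upTo (rowLength μ x))

∈-row⁻ : ∀ μ {x q} → q ∈ row μ x → proj₁ q ≡ x × q ∈Y μ
∈-row⁻ μ q∈ with ∈-map⁻ _ q∈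
... | y , y∈ , refl = refl , ∈-upTo⁻ y∈

∈-boxesOf⁺ : ∀ μ {q} → q ∈Y μ → q ∈ boxesOf μ
∈-boxesOf⁺ μ {x , y} q∈Y = ∈-concat⁺′ (∈-map⁺ (x ,_) (∈-upTo⁺ q∈Y))
  (∈-map⁺ (row μ) (∈-upTo⁺ (nthPart-length (parts μ) (≤-<-trans z≤n q∈Y))))

∈-boxesOf⁻ : ∀ μ {q} → q ∈ boxesOf μ → q ∈Y μ
∈-boxesOf⁻ μ q∈ with ∈-concat⁻′ (map (row μ) (upTo (length (parts μ)))) q∈
... | r , q∈r , r∈ with ∈-map⁻ (row μ) r∈
...   | x , _ , refl = proj₂ (∈-row⁻ μ q∈r)

boxesOf-unique : ∀ μ → Unique (boxesOf μ)
boxesOf-unique μ = Unique.concat⁺ {xss = map (row μ) (upTo (length (parts μ)))}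
  (All.map⁺ (All.universal (λ x → Unique.map⁺ (λ { refl → refl }) (Unique.upTo⁺ _)) _))
  (AllPairs.map⁺ (AllPairs.map
    (λ x≢x′ {_} (q∈ , q∈′) → x≢x′ (trans (sym (proj₁ (∈-row⁻ μ q∈))) (proj₁ (∈-row⁻ μ q∈′))))
    (Unique.upTo⁺ (length (parts μ)))))

colLength : Partition → ℕ → ℕ
colLength μ y = threshold (λ x → y <? rowLength μ x) (length (parts μ))

<colLength⁻ : ∀ μ {x y} → x < colLength μ y → (x , y) ∈Y μ
<colLength⁻ μ x< = proj₂ (threshold⁻ _ (length (parts μ)) x<)

<colLength⁺ : ∀ μ {x y} → (x , y) ∈Y μ → x < colLength μ y
<colLength⁺ μ y<λ = threshold⁺ _ (λ p → <-≤-trans p (rowLength-suc≤ μ _))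
  (nthPart-length (parts μ) (≤-<-trans z≤n y<λ)) y<λ

-- The hook is listed without repetition as an arm that contains the corner, followed by a leg
-- strictly below it; this accounts for `suc a` against `b`. Two duplicate-free lists with the same
-- members have the same length.
hookLength-formula : ∀ μ {a b} → (a , b) ∈Y μ →
  hookLength μ (a , b) ≡ (rowLength μ a ∸ b) + (colLength μ b ∸ suc a)
hookLength-formula μ {a} {b} ab∈ = trans
  (unique-length (Unique.filter⁺ _ (boxesOf-unique μ)) hook-unique to from)
  (trans (length-++ arm {leg})
    (cong₂ _+_ (length-applyUpTo armBox armLength) (length-applyUpTo legBox legLength)))
  where
  armLength legLength : ℕ
  armLength = rowLength μ a ∸ b
  legLength = colLength μ b ∸ suc a

  armBox legBox : ℕ → Box
  armBox i = a , b + i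
  legBox i = suc a + i , b

  arm leg : List Box
  arm = applyUpTo armBox armLength
  leg = applyUpTo legBox legLength

  hook-unique : Unique (arm ++ leg)
  hook-unique = Unique.++⁺ {xs = arm} {ys = leg}
    (Unique.applyUpTo⁺₁ armBox armLength λ i<j _ eq →
      <⇒≢ i<j (+-cancelˡ-≡ b _ _ (cong proj₂ eq)))
    (Unique.applyUpTo⁺₁ legBox legLength λ i<j _ eq →
      <⇒≢ i<j (+-cancelˡ-≡ (suc a) _ _ (cong proj₁ eq)))
    (λ (p , q) → let _ , _ , e = ∈-applyUpTo⁻ armBox {n = armLength} p
                     _ , _ , e′ = ∈-applyUpTo⁻ legBox {n = legLength} q
                 in m≢1+m+n a (cong proj₁ (trans (sym e) e′)))

  to : ∀ {q} → q ∈ filter (inHook? (a , b)) (boxesOf μ) → q ∈ arm ++ leg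
  to {q} q∈ with ∈-filter⁻ (inHook? (a , b)) {xs = boxesOf μ} q∈
  to {.a , y} q∈ | q∈μ , inj₁ (refl , b≤y) = ∈-++⁺ˡ
    (subst (λ z → (a , z) ∈ arm) (m+[n∸m]≡n b≤y)
      (∈-applyUpTo⁺ armBox (∸-monoˡ-< (∈-boxesOf⁻ μ q∈μ) b≤y)))
  to {x , .b} q∈ | q∈μ , inj₂ (refl , a≤x) with m≤n⇒m<n∨m≡n a≤x
  ... | inj₁ a<x = ∈-++⁺ʳ arm
    (subst (λ z → (z , b) ∈ leg) (m+[n∸m]≡n a<x)
      (∈-applyUpTo⁺ legBox (∸-monoˡ-< (<colLength⁺ μ (∈-boxesOf⁻ μ q∈μ)) a<x)))
  ... | inj₂ refl = ∈-++⁺ˡ (subst (λ z → (a , z) ∈ arm) (+-identityʳ b) (∈-applyUpTo⁺ armBox (m<n⇒0<n∸m ab∈)))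

  from : ∀ {q} → q ∈ arm ++ leg → q ∈ filter (inHook? (a , b)) (boxesOf μ)
  from q∈ with ∈-++⁻ arm q∈
  ... | inj₁ q∈arm with i , i< , refl ← ∈-applyUpTo⁻ armBox q∈arm =
    ∈-filter⁺ (inHook? (a , b)) (∈-boxesOf⁺ μ (subst (b + i <_) (m+[n∸m]≡n (<⇒≤ ab∈)) (+-monoʳ-< b i<)))
      (inj₁ (refl , m≤m+n b i))
  ... | inj₂ q∈leg with i , i< , refl ← ∈-applyUpTo⁻ legBox q∈leg =
    ∈-filter⁺ (inHook? (a , b)) (∈-boxesOf⁺ μ (<colLength⁻ μ (subst (suc a + i <_)
        (m+[n∸m]≡n (<colLength⁺ μ ab∈)) (+-monoʳ-< (suc a) i<))))
      (inj₂ (refl , ≤-trans (n≤1+n a) (m≤m+n (suc a) i)))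

nthPart-applyUpTo : ∀ (f : ℕ → ℕ) {n x} → x < n → nthPart (applyUpTo f n) x ≡ f x
nthPart-applyUpTo f {suc n} {zero}  _   = refl
nthPart-applyUpTo f {suc n} {suc x} x<n = nthPart-applyUpTo (f ∘ suc) (s<s⁻¹ x<n)

module _ (f : ℕ → ℕ) (step : ∀ x → f (suc x) ≤ f x) (n : ℕ) where
  private
    rows : ℕ
    rows = threshold (λ x → 0 <? f x) n

  fromRows : Partition
  fromRows = mkPartition (applyUpTo f rows)
    (All.applyUpTo⁺₁ f rows λ x< → proj₂ (threshold⁻ _ n x<))
    (Linked.applyUpTo⁺₂ f rows step)

  rowLength-fromRows : f n ≡ 0 → ∀ x → rowLength fromRows x ≡ f x
  rowLength-fromRows fn≡0 x with x <? rows
  ... | yes x< = nthPart-applyUpTo f x<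
  ... | no  x≮ = trans
    (nthPart-beyond (applyUpTo f rows) (≤-trans (≤-reflexive (length-applyUpTo f rows)) (≮⇒≥ x≮)))
    (sym (n<1⇒n≡0 (≰⇒> λ 0<fx → x≮ (threshold⁺ _ (λ {a} 0<f → <-≤-trans 0<f (step a)) (x<n 0<fx) 0<fx))))
    where
    x<n : 0 < f x → x < n
    x<n 0<fx = ≰⇒> λ n≤x → <⇒≱ 0<fx (≤-trans (antitone step n≤x) (≤-reflexive fn≡0))

-- Residues modulo `ℓ` as runners.

module _ (ℓ : ℕ) .{{_ : NonZero ℓ}} where

  %≡⇒multiple : ∀ {p q} → p ≤ q → p % ℓ ≡ q % ℓ → ∃[ k ] p + k * ℓ ≡ q
  %≡⇒multiple {p} {q} p≤q p~q with m≤n⇒∃[o]m+o≡n (/-monoˡ-≤ ℓ p≤q)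
  ... | k , p/ℓ+k≡q/ℓ = k , (begin
    p + k * ℓ                       ≡⟨ cong (_+ k * ℓ) (m≡m%n+[m/n]*n p ℓ) ⟩
    p % ℓ + p / ℓ * ℓ + k * ℓ       ≡⟨ +-assoc (p % ℓ) (p / ℓ * ℓ) (k * ℓ) ⟩
    p % ℓ + (p / ℓ * ℓ + k * ℓ)     ≡⟨ cong₂ _+_ p~q (sym (*-distribʳ-+ ℓ (p / ℓ) k)) ⟩
    q % ℓ + (p / ℓ + k) * ℓ         ≡⟨ cong (λ m → q % ℓ + m * ℓ) p/ℓ+k≡q/ℓ ⟩
    q % ℓ + q / ℓ * ℓ               ≡⟨ m≡m%n+[m/n]*n q ℓ ⟨
    q                               ∎)
    where open ≡-Reasoning

  ∣⇒%≡ : ∀ {c h p} → c + h ≡ p → ℓ ∣ h → c % ℓ ≡ p % ℓ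
  ∣⇒%≡ {c} refl (divides k refl) = sym ([m+kn]%n≡m%n c k ℓ)

  %≡⇒∣ : ∀ {c h p} → c + h ≡ p → c % ℓ ≡ p % ℓ → ℓ ∣ h
  %≡⇒∣ {c} {h} refl c~p =
    let k , c+kℓ≡c+h = %≡⇒multiple (m≤m+n c h) c~p
    in divides k (sym (+-cancelˡ-≡ c _ _ c+kℓ≡c+h))

  steps : ∀ p k → Star (λ p q → p + ℓ ≡ q) p (p + k * ℓ)
  steps p zero    = subst (Star _ p) (sym (+-identityʳ p)) ε
  steps p (suc k) = refl ◅ subst (Star _ (p + ℓ)) (+-assoc p ℓ (k * ℓ)) (steps (p + ℓ) k)

  -- Cut the positions into blocks of length `ℓ` by their quotients. The residue of `g` is taken in
  -- the block of `p` if it exceeds that of `p`, and in the next block if it is smaller.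
  representative : ∀ p g → ¬ g % ℓ ≡ p % ℓ → ∃[ t ] p < t × t < p + ℓ × t % ℓ ≡ g % ℓ
  representative p g g≁p with <-cmp (g % ℓ) (p % ℓ)
  ... | tri≈ _ g~p _ = contradiction g~p g≁p
  ... | tri< g<p _ _ = g % ℓ + suc (p / ℓ) * ℓ
      , (begin-strict
          p                                ≡⟨ m≡m%n+[m/n]*n p ℓ ⟩
          p % ℓ + p / ℓ * ℓ                <⟨ +-monoˡ-< (p / ℓ * ℓ) (m%n<n p ℓ) ⟩
          suc (p / ℓ) * ℓ                  ≤⟨ m≤n+m _ (g % ℓ) ⟩
          g % ℓ + suc (p / ℓ) * ℓ          ∎)
      , (begin-strict
          g % ℓ + (ℓ + p / ℓ * ℓ)          <⟨ +-monoˡ-< _ g<p ⟩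
          p % ℓ + (ℓ + p / ℓ * ℓ)          ≡⟨ cong (p % ℓ +_) (+-comm ℓ (p / ℓ * ℓ)) ⟩
          p % ℓ + (p / ℓ * ℓ + ℓ)          ≡⟨ +-assoc (p % ℓ) _ ℓ ⟨
          p % ℓ + p / ℓ * ℓ + ℓ            ≡⟨ cong (_+ ℓ) (m≡m%n+[m/n]*n p ℓ) ⟨
          p + ℓ                            ∎)
      , trans ([m+kn]%n≡m%n (g % ℓ) (suc (p / ℓ)) ℓ) (m%n%n≡m%n g ℓ)
    where open ≤-Reasoning
  ... | tri> _ _ p<g = g % ℓ + p / ℓ * ℓ
      , (begin-strict
          p                                ≡⟨ m≡m%n+[m/n]*n p ℓ ⟩
          p % ℓ + p / ℓ * ℓ                <⟨ +-monoˡ-< _ p<g ⟩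
          g % ℓ + p / ℓ * ℓ                ∎)
      , (begin-strict
          g % ℓ + p / ℓ * ℓ                <⟨ +-monoˡ-< _ (m%n<n g ℓ) ⟩
          ℓ + p / ℓ * ℓ                    ≤⟨ m≤n+m _ (p % ℓ) ⟩
          p % ℓ + (ℓ + p / ℓ * ℓ)          ≡⟨ cong (p % ℓ +_) (+-comm ℓ (p / ℓ * ℓ)) ⟩
          p % ℓ + (p / ℓ * ℓ + ℓ)          ≡⟨ +-assoc (p % ℓ) _ ℓ ⟨
          p % ℓ + p / ℓ * ℓ + ℓ            ≡⟨ cong (_+ ℓ) (m≡m%n+[m/n]*n p ℓ) ⟨
          p + ℓ                            ∎)
      , trans ([m+kn]%n≡m%n (g % ℓ) (p / ℓ) ℓ) (m%n%n≡m%n g ℓ)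
    where open ≤-Reasoning

  runners : ℓ ≥ 3 → Runners
  runners ℓ≥3 = record
    { Pos = ℕ
    ; _≺_ = _<_
    ; _↑_ = λ p q → p + ℓ ≡ q
    ; _~_ = λ p q → p % ℓ ≡ q % ℓ
    ; isSTO = <-isStrictTotalOrder
    ; ~-refl = refl
    ; ~-sym = sym
    ; ~-trans = trans
    ; ↑⇒≺ = λ { {p} refl → m<m+n p (≤-trans (s≤s z≤n) ℓ≥3) }
    ; ↑⇒~ = λ { {p} refl → sym ([m+n]%n≡m%n p ℓ) }
    ; chain = λ {p} p<q p~q → let k , p+kℓ≡q = %≡⇒multiple (<⇒≤ p<q) p~q
                              in subst (Star _ p) p+kℓ≡q (steps p k)
    ; off-runner = λ { {p} refl p<t t<q t~p → between p (%≡⇒multiple (<⇒≤ p<t) (sym t~p)) p<t t<q }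
    ; represent = λ { {p} {_} {g} refl g≁p → representative p g g≁p }
    ; two-between = λ { {p} refl → p + 1 , p + 2 , (λ eq → 1≢2 (+-cancelˡ-≡ p 1 2 eq))
        , (m<m+n p (s≤s z≤n) , +-monoʳ-< p (≤-trans (s≤s (s≤s z≤n)) ℓ≥3))
        , (m<m+n p (s≤s z≤n) , +-monoʳ-< p ℓ≥3) }
    }
    where
    1≢2 : 1 ≢ 2
    1≢2 ()
    between : ∀ p {t} → ∃[ k ] p + k * ℓ ≡ t → p < t → t < p + ℓ → ⊥
    between p (zero  , refl) p<t _ = <-irrefl (sym (+-identityʳ p)) p<t
    between p (suc k , refl) _ t<q = <⇒≱ (+-cancelˡ-< p _ _ t<q) (m≤m+n ℓ (k * ℓ))

-- The boundary of a partition as an abacus.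

module Heights (N : ℕ) where

  -- The bound `N` survives removals, so one `N` numbers the positions of all partitions in an
  -- induction; the shift by `N` keeps positions natural numbers.
  Fits : Partition → Set
  Fits μ = ∀ {x y} → (x , y) ∈Y μ → x < N

  -- The boundary of μ crosses the diagonal of the boxes (x , y) with p + x ≡ y + N
  -- (the content shifted by N) at depth height μ p. Passing from p to suc p the
  -- boundary goes up one row (a bead) or right one column (a gap).
  opaque
    height : Partition → ℕ → ℕ
    height μ p = threshold (λ x → p + x <? rowLength μ x + N) N

    height⁻ : ∀ μ p {x} → x < height μ p → x < N × p + x < rowLength μ x + N
    height⁻ μ p = threshold⁻ _ N

    height⁺ : ∀ μ p {x} → x < N → p + x < rowLength μ x + N → x < height μ p
    height⁺ μ p = threshold⁺ _ λ {x} lt →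
      ≤-<-trans (+-monoʳ-≤ p (n≤1+n x)) (<-≤-trans lt (+-monoˡ-≤ N (rowLength-suc≤ μ x)))

  module _ (μ : Partition) where

    height-suc≤ : ∀ p → height μ (suc p) ≤ height μ p
    height-suc≤ p = <⇒≤-pointwise λ x< →
      let x<N , lt = height⁻ μ (suc p) x< in height⁺ μ p x<N (<-trans (n<1+n _) lt)

    height≤suc : ∀ p → height μ p ≤ suc (height μ (suc p))
    height≤suc p = <⇒≤-pointwise λ
      { {zero}  _  → z<s
      ; {suc x} x< → let x<N , lt = height⁻ μ p x<
                     in s<s (height⁺ μ (suc p) (<-trans (n<1+n x) x<N)
                          (≤-trans (≤-reflexive (cong suc (sym (+-suc p x))))
                             (<-≤-trans lt (+-monoˡ-≤ N (rowLength-suc≤ μ x)))))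
      }

    Bead Gap : ℕ → Set
    Bead p = height μ p ≡ suc (height μ (suc p))
    Gap  p = height μ p ≡ height μ (suc p)

    bead⊎gap : ∀ p → Bead p ⊎ Gap p
    bead⊎gap p with m≤n⇒m<n∨m≡n (height≤suc p)
    ... | inj₁ lt = inj₂ (≤-antisym (s≤s⁻¹ lt) (height-suc≤ p))
    ... | inj₂ eq = inj₁ eq

    bead∧gap⇒⊥ : ∀ {p} → Bead p → Gap p → ⊥
    bead∧gap⇒⊥ bead gap = 1+n≢n (trans (sym bead) gap)

    -- Row lengths weakly decrease, so at this `p` the rows counted for `suc p` are those above `x`,
    -- and `p` gains row `x`. The beads form the β-set of `μ` with `N` elements.
    row⇒bead : ∀ {x p} → x < N → p + suc x ≡ rowLength μ x + N → Bead p
    row⇒bead {x} {p} x<N eq = trans height-p (cong suc (sym height-suc))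
      where
      height-suc : height μ (suc p) ≡ x
      height-suc = ≤-antisym
        (<⇒≤-pointwise λ {a} a< → ≰⇒> λ x≤a → <-irrefl refl (begin-strict
          suc p + a          <⟨ proj₂ (height⁻ μ (suc p) a<) ⟩
          rowLength μ a + N  ≤⟨ +-monoˡ-≤ N (rowLength-antitone μ x≤a) ⟩
          rowLength μ x + N  ≡⟨ eq ⟨
          p + suc x          ≡⟨ +-suc p x ⟩
          suc p + x          ≤⟨ +-monoʳ-≤ (suc p) x≤a ⟩
          suc p + a          ∎))
        (<⇒≤-pointwise λ {a} a<x → height⁺ μ (suc p) (<-trans a<x x<N) (begin-strict
          suc p + a          <⟨ +-monoʳ-< (suc p) a<x ⟩
          suc p + x          ≡⟨ +-suc p x ⟨
          p + suc x          ≡⟨ eq ⟩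
          rowLength μ x + N  ≤⟨ +-monoˡ-≤ N (rowLength-antitone μ (<⇒≤ a<x)) ⟩
          rowLength μ a + N  ∎))
        where open ≤-Reasoning
      height-p : height μ p ≡ suc x
      height-p = ≤-antisym (subst (λ h → height μ p ≤ suc h) height-suc (height≤suc p))
        (height⁺ μ p x<N (≤-reflexive (trans (sym (+-suc p x)) eq)))

    bead⇒row : ∀ {p} → Bead p → ∃[ x ] x < N × p + suc x ≡ rowLength μ x + N
    bead⇒row {p} bead =
      let x         = height μ (suc p)
          x<N , lt  = height⁻ μ p (≤-reflexive (sym bead))
      in x , x<N , ≤-antisym (≤-trans (≤-reflexive (+-suc p x)) lt)
           (≮⇒≥ λ lt′ → <-irrefl refl (height⁺ μ (suc p) x<N (≤-<-trans (≤-reflexive (sym (+-suc p x))) lt′)))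

    module _ (fits : Fits μ) where

      ∈Y⇒<height : ∀ {p x y} → p + x ≡ y + N → (x , y) ∈Y μ → x < height μ p
      ∈Y⇒<height {p} eq y<λ = height⁺ μ p (fits y<λ) (≤-<-trans (≤-reflexive eq) (+-monoˡ-< N y<λ))

      <height⇒∈Y : ∀ {p x y} → p + x ≡ y + N → x < height μ p → (x , y) ∈Y μ
      <height⇒∈Y {p} eq x< = +-cancelʳ-< N _ _ (≤-<-trans (≤-reflexive (sym eq)) (proj₂ (height⁻ μ p x<)))

      -- Both diagonals `p` and `suc p` reach exactly the depth at which column `y` ends, so the
      -- boundary goes right between them.
      col⇒gap : ∀ {y p} → p + colLength μ y ≡ y + N → Gap p
      col⇒gap {y} {p} eq = ≤-antisym (≤-trans upper lower) (height-suc≤ p)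
        where
        open ≤-Reasoning
        upper : height μ p ≤ colLength μ y
        upper = <⇒≤-pointwise λ {a} a< → ≰⇒> λ λ′≤a → ≤⇒≯ λ′≤a
          (<colLength⁺ μ (+-cancelʳ-< N y _ (begin-strict
            y + N              ≡⟨ eq ⟨
            p + colLength μ y  ≤⟨ +-monoʳ-≤ p λ′≤a ⟩
            p + a              <⟨ proj₂ (height⁻ μ p a<) ⟩
            rowLength μ a + N  ∎)))
        lower : colLength μ y ≤ height μ (suc p)
        lower = <⇒≤-pointwise λ {a} a< → height⁺ μ (suc p) (fits (<colLength⁻ μ a<)) (begin-strict
            suc p + a          ≡⟨ +-suc p a ⟨
            p + suc a          ≤⟨ +-monoʳ-≤ p a< ⟩
            p + colLength μ y  ≡⟨ eq ⟩
            y + N              <⟨ +-monoˡ-< N (<colLength⁻ μ a<) ⟩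
            rowLength μ a + N  ∎)

      -- Rows `x` with `p + x < N` are counted by `height` whatever `μ` is: there the diagonal still
      -- runs to the left of the diagram.
      N≤p+height : ∀ p → N ≤ p + height μ p
      N≤p+height p with height μ p <? N
      ... | yes h<N = ≤-trans (m≤n+m N _) (≮⇒≥ λ lt → <-irrefl refl (height⁺ μ p h<N lt))
      ... | no  h≮N = ≤-trans (≮⇒≥ h≮N) (m≤n+m _ p)

      gap⇒col : ∀ {p} → Gap p → ∃[ y ] p + colLength μ y ≡ y + N
      gap⇒col {p} gap = y , trans (cong (p +_) (sym col)) (sym y+N)
        where
        open ≤-Reasoning
        -- The column of the place on diagonal `p` in row `height μ p`, the first one outside the
        -- diagram.
        y = p + height μ p ∸ N
        y+N : y + N ≡ p + height μ p
        y+N = m∸n+n≡m (N≤p+height p)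
        inCol : ∀ {a} → a < height μ p → (a , y) ∈Y μ
        inCol {a} a< with m≤n⇒∃[o]m+o≡n a<
        ... | o , h-eq = +-cancelʳ-< N _ _ (begin-strict
          y + N                    ≡⟨ y+N ⟩
          p + height μ p           ≡⟨ cong (p +_) h-eq ⟨
          p + suc (a + o)          ≡⟨ +-suc p (a + o) ⟩
          suc p + (a + o)          <⟨ proj₂ (height⁻ μ (suc p) (≤-reflexive (trans h-eq gap))) ⟩
          rowLength μ (a + o) + N  ≤⟨ +-monoˡ-≤ N (rowLength-antitone μ (m≤m+n a o)) ⟩
          rowLength μ a + N        ∎)
        col : height μ p ≡ colLength μ y
        col = ≤-antisym (<⇒≤-pointwise (<colLength⁺ μ ∘ inCol))
          (<⇒≤-pointwise λ {a} a< → ≰⇒> λ h≤a →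
            let y<λa = <colLength⁻ μ a< in
            <-irrefl refl (height⁺ μ p (≤-<-trans h≤a (fits y<λa)) (begin-strict
              p + height μ p               ≡⟨ y+N ⟨
              y + N                        <⟨ +-monoˡ-< N y<λa ⟩
              rowLength μ a + N            ≤⟨ +-monoˡ-≤ N (rowLength-antitone μ h≤a) ⟩
              rowLength μ (height μ p) + N ∎)))

-- The JM condition as absence of violations.

module RimHooks (ℓ : ℕ) (ℓ≥3 : ℓ ≥ 3) (N : ℕ) where
  instance
    ℓ≢0 : NonZero ℓ
    ℓ≢0 = >-nonZero (≤-trans (s≤s z≤n) ℓ≥3)

  open Heights N
  open Abacus (runners ℓ ℓ≥3)

  config : Partition → Config
  config μ = record
    { Bead = Bead μ ; Gap = Gap μ ; cover = bead⊎gap μ ; disjoint = bead∧gap⇒⊥ μ }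

  hookLength-difference : ∀ μ {x y p c} → (x , y) ∈Y μ →
    p + suc x ≡ rowLength μ x + N → c + colLength μ y ≡ y + N → c + hookLength μ (x , y) ≡ p
  hookLength-difference μ {x} {y} {p} {c} xy∈ p-eq c-eq = +-cancelʳ-≡ (suc x) _ _ (begin
    c + hookLength μ (x , y) + suc x ≡⟨ cong (λ h → c + h + suc x) (hookLength-formula μ xy∈) ⟩
    c + (arm + leg) + suc x          ≡⟨ rearrange c arm leg x ⟩
    arm + (c + (leg + suc x))        ≡⟨ cong (λ k → arm + (c + k)) (m∸n+n≡m (<colLength⁺ μ xy∈)) ⟩
    arm + (c + colLength μ y)        ≡⟨ cong (arm +_) c-eq ⟩
    arm + (y + N)                    ≡⟨ +-assoc arm y N ⟨
    arm + y + N                      ≡⟨ cong (_+ N) (m∸n+n≡m (<⇒≤ xy∈)) ⟩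
    rowLength μ x + N                ≡⟨ p-eq ⟨
    p + suc x                        ∎)
    where
    open ≡-Reasoning
    arm = rowLength μ x ∸ y
    leg = colLength μ y ∸ suc x
    rearrange : ∀ c i j x → c + (i + j) + suc x ≡ i + (c + (j + suc x))
    rearrange = solve-∀

  ∈Y⇒< : ∀ μ {x y p c} → (x , y) ∈Y μ →
    p + suc x ≡ rowLength μ x + N → c + colLength μ y ≡ y + N → c < p
  ∈Y⇒< μ {x} {y} {p} {c} xy∈ p-eq c-eq = +-cancelʳ-< (suc x) c p (begin-strict
    c + suc x         ≤⟨ +-monoʳ-≤ c (<colLength⁺ μ xy∈) ⟩
    c + colLength μ y ≡⟨ c-eq ⟩
    y + N             <⟨ +-monoˡ-< N xy∈ ⟩
    rowLength μ x + N ≡⟨ p-eq ⟨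
    p + suc x         ∎)
    where open ≤-Reasoning

  <⇒∈Y : ∀ μ {x y p c} → c < p →
    p + suc x ≡ rowLength μ x + N → c + colLength μ y ≡ y + N → (x , y) ∈Y μ
  <⇒∈Y μ {x} {y} {p} {c} c<p p-eq c-eq = ≰⇒> λ λ≤y → <⇒≱ c<p (+-cancelʳ-≤ (suc x) p c (begin
    p + suc x         ≡⟨ p-eq ⟩
    rowLength μ x + N ≤⟨ +-monoˡ-≤ N λ≤y ⟩
    y + N             ≡⟨ c-eq ⟨
    c + colLength μ y ≤⟨ +-monoʳ-≤ c (≤-trans (≮⇒≥ λ x<λ′ → ≤⇒≯ λ≤y (<colLength⁻ μ x<λ′)) (n≤1+n x)) ⟩
    c + suc x         ∎))
    where open ≤-Reasoning

  jm⇒¬violation : ∀ μ → Fits μ → IsJM ℓ μ → ¬ Violation (config μ)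
  jm⇒¬violation μ fits jm v =
    let open Violation v
        a , _ , a-eq = bead⇒row μ bead-r
        x , _ , x-eq = bead⇒row μ bead-b
        b , b-eq = gap⇒col μ fits gap-c
        y , y-eq = gap⇒col μ fits gap-g
        ab∈ = <⇒∈Y μ c≺r a-eq b-eq
        ay∈ = <⇒∈Y μ g≺r a-eq y-eq
        xb∈ = <⇒∈Y μ c≺b x-eq b-eq
    in jm (a , b , x , y , ab∈ , ay∈ , xb∈
          , %≡⇒∣ ℓ (hookLength-difference μ ab∈ a-eq b-eq) c~r
          , (λ ℓ∣ → g≁r (∣⇒%≡ ℓ (hookLength-difference μ ay∈ a-eq y-eq) ℓ∣))
          , (λ ℓ∣ → b≁c (sym (∣⇒%≡ ℓ (hookLength-difference μ xb∈ x-eq b-eq) ℓ∣))))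

  ¬violation⇒jm : ∀ μ → Fits μ → ¬ Violation (config μ) → IsJM ℓ μ
  ¬violation⇒jm μ fits ¬v (a , b , x , y , ab∈ , ay∈ , xb∈ , ℓ∣ab , ℓ∤ay , ℓ∤xb) =
    let r , r-eq = rowPosition ab∈
        s , s-eq = rowPosition xb∈
        c , c-eq = colPosition ab∈
        g , g-eq = colPosition ay∈
    in ¬v record
      { bead-r = row⇒bead μ (fits ab∈) r-eq
      ; gap-c  = col⇒gap μ fits c-eq
      ; gap-g  = col⇒gap μ fits g-eq
      ; bead-b = row⇒bead μ (fits xb∈) s-eq
      ; c≺r = ∈Y⇒< μ ab∈ r-eq c-eq
      ; g≺r = ∈Y⇒< μ ay∈ r-eq g-eq
      ; c≺b = ∈Y⇒< μ xb∈ s-eq c-eq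
      ; c~r = ∣⇒%≡ ℓ (hookLength-difference μ ab∈ r-eq c-eq) ℓ∣ab
      ; g≁r = λ g~r → ℓ∤ay (%≡⇒∣ ℓ (hookLength-difference μ ay∈ r-eq g-eq) g~r)
      ; b≁c = λ b~c → ℓ∤xb (%≡⇒∣ ℓ (hookLength-difference μ xb∈ s-eq c-eq) (sym b~c))
      }
    where
    rowPosition : ∀ {x y} → (x , y) ∈Y μ → ∃[ p ] p + suc x ≡ rowLength μ x + N
    rowPosition xy∈ = _ , m∸n+n≡m (≤-trans (fits xy∈) (m≤n+m N _))

    colPosition : ∀ {x y} → (x , y) ∈Y μ → ∃[ c ] c + colLength μ y ≡ y + N
    colPosition {y = y} _ = _ , m∸n+n≡m (≤-trans
      (<⇒≤-pointwise (fits ∘ <colLength⁻ μ)) (m≤n+m N y))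

  -- Removing a rim hook as moving a bead.

  -- Box (x , y) is the last box of μ on the diagonal with index p.
  RimAt : Partition → ℕ → Box → Set
  RimAt μ p (x , y) = p + x ≡ y + N × height μ p ≡ suc x

  rimAt-index : ∀ μ {p p′ q} → RimAt μ p q → RimAt μ p′ q → p ≡ p′
  rimAt-index μ (e , _) (e′ , _) = +-cancelʳ-≡ _ _ _ (trans e (sym e′))

  rimAt-adjacent : ∀ μ {p q q′} → RimAt μ p q → RimAt μ (suc p) q′ → ShareEdge q q′
  rimAt-adjacent μ {p} {x , y} {x′ , y′} (e , h) (e′ , h′) with bead⊎gap μ p
  ... | inj₁ bead with suc-injective (trans (sym h) (trans bead (cong suc h′)))
  ...   | refl with +-cancelʳ-≡ N y y′ (trans (sym e) (trans (+-suc p x′) e′))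
  ...     | refl = above
  rimAt-adjacent μ {p} {x , y} {x′ , y′} (e , h) (e′ , h′) | inj₂ gap
    with suc-injective (trans (sym h) (trans gap h′))
  ... | refl with +-cancelʳ-≡ N (suc y) y′ (trans (cong suc (sym e)) e′)
  ...   | refl = right

  shareEdge-index : ∀ {p p′ x y x′ y′} → ShareEdge (x , y) (x′ , y′) →
    p + x ≡ y + N → p′ + x′ ≡ y′ + N → p′ ≤ suc p
  shareEdge-index {p} {p′} {x} right e e′ = ≤-reflexive (+-cancelʳ-≡ x p′ (suc p) (trans e′ (cong suc (sym e))))
  shareEdge-index {p} {p′} {x} left e e′ =
    ≤-trans (n≤1+n p′) (≤-trans (≤-reflexive (+-cancelʳ-≡ x (suc p′) p (trans (cong suc e′) (sym e)))) (n≤1+n p))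
  shareEdge-index {p} {p′} {x} below e e′ =
    ≤-trans (n≤1+n p′) (≤-trans (≤-reflexive
      (+-cancelʳ-≡ x (suc p′) p (trans (sym (+-suc p′ x)) (trans e′ (sym e))))) (n≤1+n p))
  shareEdge-index {p} {p′} {_} {_} {x′} above e e′ =
    ≤-reflexive (+-cancelʳ-≡ x′ p′ (suc p) (trans e′ (trans (sym e) (+-suc p x′))))

  index : Box → ℕ
  index (x , y) = y + N ∸ x

  -- The hook occupies one rim box on each of the `ℓ` diagonals `c + 1` to `c + ℓ`. They lie between
  -- boundary steps `c` and `c + ℓ`, the ends of the bead's move, which is why `c` itself is
  -- excluded.
  record Spans (μ : Partition) (bs : List Box) (c : ℕ) : Set where
    field
      onRim  : ∀ {q} → q ∈ bs → ∃[ p ] c < p × p ≤ c + ℓ × RimAt μ p q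
      covers : ∀ {p} → c < p → p ≤ c + ℓ → ∃[ q ] q ∈ bs × RimAt μ p q

  module _ {μ : Partition} (R : RimHook ℓ μ) where
    private
      ν = remaining R

    hook-inside : ∀ {q} → q ∈ boxes R → q ∈Y μ
    hook-inside q∈ = All.lookup (inside R) q∈

    hook-removed : ∀ {q} → q ∈ boxes R → ¬ q ∈Y ν
    hook-removed q∈ q∈ν = proj₂ (Equivalence.to (removal R _) q∈ν) q∈

    remaining⊆ : ∀ {q} → q ∈Y ν → q ∈Y μ
    remaining⊆ q∈ν = proj₁ (Equivalence.to (removal R _) q∈ν)

    remaining⁺ : ∀ {q} → q ∈Y μ → q ∉ boxes R → q ∈Y ν
    remaining⁺ q∈μ q∉R = Equivalence.from (removal R _) (q∈μ , q∉R)

    hook⁺ : ∀ {q} → q ∈Y μ → ¬ q ∈Y ν → q ∈ boxes R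
    hook⁺ {q} q∈μ q∉ν with q ∈? boxes R
    ... | yes q∈R = q∈R
    ... | no  q∉R = contradiction (remaining⁺ q∈μ q∉R) q∉ν

    fits-remaining : Fits μ → Fits ν
    fits-remaining fits q∈ν = fits (remaining⊆ q∈ν)

    hook-nonempty : ∃[ q ] q ∈ boxes R
    hook-nonempty with boxes R | size R
    ... | []    | refl = contradiction ℓ≥3 λ ()
    ... | q ∷ _ | _    = q , here refl

    size-remaining< : length (boxesOf ν) < length (boxesOf μ)
    size-remaining< =
      let q , q∈R = hook-nonempty
      in unique⊆⇒length≤
           (All.tabulate (λ q′∈ q≡q′ → hook-removed q∈R (subst (_∈Y ν) (sym q≡q′) (∈-boxesOf⁻ ν q′∈)))
             ∷ boxesOf-unique ν)
           λ { (here refl) → ∈-boxesOf⁺ μ (hook-inside q∈R)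
             ; (there q′∈) → ∈-boxesOf⁺ μ (remaining⊆ (∈-boxesOf⁻ ν q′∈)) }

    -- Nothing weakly below and to the right of a removed box can remain, so a box of `μ` diagonally
    -- after it would put a full square into the hook.
    hook-outer : ∀ {x y} → (x , y) ∈ boxes R → ¬ (suc x , suc y) ∈Y μ
    hook-outer {x} {y} q∈R out∈μ = no2×2 R (x , y , q∈R
      , hook⁺ (∈Y-closed μ (n≤1+n x) ≤-refl out∈μ) (not-remaining ≤-refl (n≤1+n y))
      , hook⁺ (∈Y-closed μ ≤-refl (n≤1+n y) out∈μ) (not-remaining (n≤1+n x) ≤-refl)
      , hook⁺ out∈μ (not-remaining (n≤1+n x) (n≤1+n y)))
      where
      not-remaining : ∀ {x′ y′} → x ≤ x′ → y ≤ y′ → ¬ (x′ , y′) ∈Y ν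
      not-remaining x≤x′ y≤y′ q′∈ν = hook-removed q∈R (∈Y-closed ν x≤x′ y≤y′ q′∈ν)

    module _ (fits : Fits μ) where
      hook-rimAt : ∀ {q} → q ∈ boxes R → RimAt μ (index q) q
      hook-rimAt {x , y} q∈R = eq , ≤-antisym
        (≮⇒≥ λ sx< → hook-outer q∈R (<height⇒∈Y μ fits (trans (+-suc (index (x , y)) x) (cong suc eq)) sx<))
        (∈Y⇒<height μ fits eq (hook-inside q∈R))
        where
        eq : index (x , y) + x ≡ y + N
        eq = m∸n+n≡m (≤-trans (<⇒≤ (fits (hook-inside q∈R))) (m≤n+m N y))

      -- The index rises by at most one along an edge, so a path skips no value.
      hook-crosses : ∀ {q q′ p} → Star (StepIn (boxes R)) q q′ → q ∈ boxes R →
                     index q ≤ p → p ≤ index q′ → ∃[ q″ ] q″ ∈ boxes R × index q″ ≡ p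
      hook-crosses ε q∈R q≤p p≤q = _ , q∈R , ≤-antisym q≤p p≤q
      hook-crosses {q} ((_ , q₁∈R , edge) ◅ rest) q∈R q≤p p≤q′ with m≤n⇒m<n∨m≡n q≤p
      ... | inj₂ q≡p = q , q∈R , q≡p
      ... | inj₁ q<p = hook-crosses rest q₁∈R
        (≤-trans (shareEdge-index edge (proj₁ (hook-rimAt q∈R)) (proj₁ (hook-rimAt q₁∈R))) q<p) p≤q′

  rimBox : Partition → ℕ → Box
  rimBox μ p = pred (height μ p) , p + pred (height μ p) ∸ N

  rimBox-unique : ∀ μ {p q} → RimAt μ p q → rimBox μ p ≡ q
  rimBox-unique μ {p} {x , y} (e , h) = cong₂ _,_ (cong pred h)
    (trans (cong (λ h → p + pred h ∸ N) h) (trans (cong (_∸ N) e) (m+n∸n≡m y N)))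

  -- Connectedness makes the indices fill the interval from `m` to `M`, and a rim box is determined
  -- by its index. Hence the hook has `M ∸ m + 1` boxes; this number being `ℓ`, the window starts
  -- just after `pred m`.
  hook-spans : ∀ {μ} (R : RimHook ℓ μ) → Fits μ → ∃[ c ] Spans μ (boxes R) c
  hook-spans {μ} R fits = pred m , record
    { onRim = λ {q} q∈R → index q , subst (_≤ index q) (sym suc-pred-m) (m≤ q∈R)
                        , subst (index q ≤_) (sym last) (≤M q∈R) , rimAt q∈R
    ; covers = λ {p} c<p p≤c+ℓ →
        let q , q∈R , eq = crossed (subst (_≤ p) suc-pred-m c<p) (subst (p ≤_) last p≤c+ℓ)
        in q , q∈R , subst (λ i → RimAt μ i q) eq (rimAt q∈R)
    }
    where
    rimAt : ∀ {q} → q ∈ boxes R → RimAt μ (index q) q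
    rimAt = hook-rimAt R fits

    q₀ lo hi : Box
    q₀ = proj₁ (hook-nonempty R)
    lo = argmin index q₀ (boxes R)
    hi = argmax index q₀ (boxes R)

    lo∈ : lo ∈ boxes R
    lo∈ = argmin-all index (proj₂ (hook-nonempty R)) (All.tabulate id)

    hi∈ : hi ∈ boxes R
    hi∈ = argmax-all index (proj₂ (hook-nonempty R)) (All.tabulate id)

    m M : ℕ
    m = index lo
    M = index hi

    m≤ : ∀ {q} → q ∈ boxes R → m ≤ index q
    m≤ = All.lookup (f[argmin]≤f[xs] q₀ (boxes R))

    ≤M : ∀ {q} → q ∈ boxes R → index q ≤ M
    ≤M = All.lookup (f[xs]≤f[argmax] q₀ (boxes R))

    -- The smallest index is positive because the row of `lo` is less than `N`.
    suc-pred-m : suc (pred m) ≡ m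
    suc-pred-m = suc-pred m
      {{>-nonZero (m<n⇒0<n∸m (≤-trans (fits (hook-inside R lo∈)) (m≤n+m N (proj₂ lo))))}}

    crossed : ∀ {p} → m ≤ p → p ≤ M → ∃[ q ] q ∈ boxes R × index q ≡ p
    crossed = hook-crosses R fits (connected R lo∈ hi∈) lo∈

    crossed-rimBox : ∀ {p} → m ≤ p → p ≤ M → rimBox μ p ∈ boxes R × index (rimBox μ p) ≡ p
    crossed-rimBox m≤p p≤M with crossed m≤p p≤M
    ... | q , q∈R , refl with rimBox-unique μ (rimAt q∈R)
    ...   | eq = subst (_∈ boxes R) (sym eq) q∈R , cong index eq

    rim : ℕ → Box
    rim i = rimBox μ (m + i)

    inRange : ∀ {i} → i < suc (M ∸ m) → m + i ≤ M
    inRange i< = ≤-trans (+-monoʳ-≤ m (s≤s⁻¹ i<)) (≤-reflexive (m+[n∸m]≡n (m≤ hi∈)))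

    count : ℓ ≡ suc (M ∸ m)
    count = trans (sym (size R)) (trans
      (unique-length (unique R) (Unique.applyUpTo⁺₁ rim _ distinct) to from)
      (length-applyUpTo rim _))
      where
      distinct : ∀ {i j} → i < j → j < suc (M ∸ m) → rim i ≢ rim j
      distinct {i} {j} i<j j< eq = <⇒≢ i<j (+-cancelˡ-≡ m i j (begin
        m + i       ≡⟨ proj₂ (crossed-rimBox (m≤m+n m i) (inRange (<-trans i<j j<))) ⟨
        index (rim i)  ≡⟨ cong index eq ⟩
        index (rim j)  ≡⟨ proj₂ (crossed-rimBox (m≤m+n m j) (inRange j<)) ⟩
        m + j       ∎))
        where open ≡-Reasoning
      to : ∀ {q} → q ∈ boxes R → q ∈ applyUpTo rim (suc (M ∸ m))
      to {q} q∈R = subst (_∈ _) (trans (cong (rimBox μ) (m+[n∸m]≡n (m≤ q∈R))) (rimBox-unique μ (rimAt q∈R)))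
        (∈-applyUpTo⁺ rim (s≤s (∸-monoˡ-≤ m (≤M q∈R))))
      from : ∀ {q} → q ∈ applyUpTo rim (suc (M ∸ m)) → q ∈ boxes R
      from q∈ with ∈-applyUpTo⁻ rim q∈
      ... | i , i< , refl = proj₁ (crossed-rimBox (m≤m+n m i) (inRange i<))

    last : pred m + ℓ ≡ M
    last = begin
      pred m + ℓ              ≡⟨ cong (pred m +_) count ⟩
      pred m + suc (M ∸ m)    ≡⟨ +-suc (pred m) (M ∸ m) ⟩
      suc (pred m) + (M ∸ m)  ≡⟨ cong (_+ (M ∸ m)) suc-pred-m ⟩
      m + (M ∸ m)             ≡⟨ m+[n∸m]≡n (m≤ hi∈) ⟩
      M                       ∎
      where open ≡-Reasoning

  module _ {μ : Partition} (R : RimHook ℓ μ) (fits : Fits μ) {c : ℕ} (spans : Spans μ (boxes R) c) where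
    open Spans spans
    private
      ν = remaining R

    height-remaining≤ : ∀ p → height ν p ≤ height μ p
    height-remaining≤ p = <⇒≤-pointwise λ {a} a< →
      let a<N , lt = height⁻ ν p a<
      in height⁺ μ p a<N (<-≤-trans lt (+-monoˡ-≤ N (<⇒≤-pointwise (remaining⊆ R))))

    <height-remaining : ∀ {p a} → a < height μ p →
                        (∀ {y} → p + a ≡ y + N → (a , y) ∉ boxes R) → a < height ν p
    <height-remaining {p} {a} a< a∉ with height⁻ μ p a< | p + a <? N
    -- A place left of the diagram is no box and is counted for every partition.
    ... | a<N , _ | yes p+a<N = height⁺ ν p a<N (<-≤-trans p+a<N (m≤n+m N _))
    ... | a<N , _ | no  p+a≮N =
      let eq = sym (m∸n+n≡m (≮⇒≥ p+a≮N))
      in ∈Y⇒<height ν (fits-remaining R fits) eq (remaining⁺ R (<height⇒∈Y μ fits eq a<) (a∉ eq))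

    onRim-at : ∀ {p a y} → p + a ≡ y + N → (a , y) ∈ boxes R → c < p × p ≤ c + ℓ × height μ p ≡ suc a
    onRim-at {p} {a} {y} eq a∈R with onRim a∈R
    ... | p′ , c<p′ , p′≤ , eq′ , h with +-cancelʳ-≡ a p p′ (trans eq (sym eq′))
    ...   | refl = c<p′ , p′≤ , h

    height-outside : ∀ {p} → ¬ (c < p × p ≤ c + ℓ) → height ν p ≡ height μ p
    height-outside {p} out = ≤-antisym (height-remaining≤ p) (<⇒≤-pointwise λ a< →
      <height-remaining a< λ eq a∈R → let c<p , p≤ , _ = onRim-at eq a∈R in out (c<p , p≤))

    height-range : ∀ {p} → c < p → p ≤ c + ℓ → height μ p ≡ suc (height ν p)
    height-range {p} c<p p≤c+ℓ with covers c<p p≤c+ℓ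
    ... | (x , y) , q∈R , eq , h = trans h (cong suc (≤-antisym lower upper))
      where
      lower : x ≤ height ν p
      lower = <⇒≤-pointwise λ {a} a<x →
        <height-remaining (<-trans a<x (≤-reflexive (sym h))) λ eq′ a∈R →
          <⇒≢ a<x (suc-injective (trans (sym (proj₂ (proj₂ (onRim-at eq′ a∈R)))) h))
      upper : height ν p ≤ x
      upper = ≮⇒≥ λ x< → hook-removed R q∈R (<height⇒∈Y ν (fits-remaining R fits) eq x<)

    private
      0<ℓ : 0 < ℓ
      0<ℓ = ≤-trans (s≤s z≤n) ℓ≥3

      out-c : height ν c ≡ height μ c
      out-c = height-outside λ (c<c , _) → <-irrefl refl c<c

      out-top : height ν (suc (c + ℓ)) ≡ height μ (suc (c + ℓ))
      out-top = height-outside λ (_ , ≤c+ℓ) → <-irrefl refl ≤c+ℓ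

      in-c : height μ (suc c) ≡ suc (height ν (suc c))
      in-c = height-range ≤-refl (m<m+n c 0<ℓ)

      in-top : height μ (c + ℓ) ≡ suc (height ν (c + ℓ))
      in-top = height-range (m<m+n c 0<ℓ) ≤-refl

      side : ∀ t → t ≢ c → t ≢ c + ℓ →
        (height ν t ≡ height μ t × height ν (suc t) ≡ height μ (suc t)) ⊎
        (height μ t ≡ suc (height ν t) × height μ (suc t) ≡ suc (height ν (suc t)))
      side t t≢c t≢top with c <? t | t <? c + ℓ
      ... | no c≮t  | _ = inj₁
        ( height-outside (λ (c<t , _) → c≮t c<t)
        , height-outside (λ (c<st , _) → t≢c (≤-antisym (≮⇒≥ c≮t) (s≤s⁻¹ c<st))))
      ... | yes c<t | yes t<top = inj₂
        (height-range c<t (<⇒≤ t<top) , height-range (<-trans c<t (n<1+n t)) t<top)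
      ... | yes _   | no t≮top = inj₁
        ( height-outside (λ (_ , t≤top) → t≢top (≤-antisym t≤top (≮⇒≥ t≮top)))
        , height-outside (λ (_ , t<top) → t≮top t<top))

    -- The removal lowers the height by one exactly for `c < p` and `p ≤ c + ℓ`. Differences of
    -- consecutive heights therefore change only at the two ends of this window.
    hook-moved : Moved c (c + ℓ) (config μ) (config ν)
    hook-moved = record
      { gap-p = gap-c ; bead-q = bead-top ; bead-p′ = bead-c′ ; gap-q′ = gap-top′
      ; bead′ = λ {t} bead t≢top → case side t (λ { refl → bead∧gap⇒⊥ μ bead gap-c }) t≢top of λ
          { (inj₁ (e , e′)) → trans e (trans bead (cong suc (sym e′)))
          ; (inj₂ (e , e′)) → suc-injective (trans (sym e) (trans bead (cong suc e′))) }
      ; gap′ = λ {t} gap t≢c → case side t t≢c (λ { refl → bead∧gap⇒⊥ μ bead-top gap }) of λ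
          { (inj₁ (e , e′)) → trans e (trans gap (sym e′))
          ; (inj₂ (e , e′)) → suc-injective (trans (sym e) (trans gap e′)) }
      }
      where
      -- The height of ν at suc c is one less than that of μ, which forces the steps at c.
      gap-c : Gap μ c
      gap-c with bead⊎gap μ c
      ... | inj₂ gap = gap
      ... | inj₁ bead = contradiction (begin-strict
        suc (height ν (suc c)) <⟨ n<1+n _ ⟩
        2 + height ν (suc c)   ≡⟨ cong suc in-c ⟨
        suc (height μ (suc c)) ≡⟨ bead ⟨
        height μ c             ≡⟨ out-c ⟨
        height ν c             ∎) (≤⇒≯ (height≤suc ν c))
        where open ≤-Reasoning
      bead-c′ : Bead ν c
      bead-c′ = trans out-c (trans gap-c in-c)
      bead-top : Bead μ (c + ℓ)
      bead-top with bead⊎gap μ (c + ℓ)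
      ... | inj₁ bead = bead
      ... | inj₂ gap = contradiction (begin-strict
        height ν (c + ℓ)        <⟨ n<1+n _ ⟩
        suc (height ν (c + ℓ))  ≡⟨ in-top ⟨
        height μ (c + ℓ)        ≡⟨ gap ⟩
        height μ (suc (c + ℓ))  ≡⟨ out-top ⟨
        height ν (suc (c + ℓ))  ∎) (≤⇒≯ (height-suc≤ ν (c + ℓ)))
        where open ≤-Reasoning
      gap-top′ : Gap ν (c + ℓ)
      gap-top′ = trans (suc-injective (trans (sym in-top) bead-top)) (sym out-top)

  module _ {μ : Partition} (R : RimHook ℓ μ) {c : ℕ} (spans : Spans μ (boxes R) c) where
    open Spans spans

    horizontal⇒gaps : Horizontal R → AllGaps (config μ) c (c + ℓ)
    horizontal⇒gaps (x₀ , inRow) (c<t , t<top)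
      with covers c<t (<⇒≤ t<top) | covers (<-trans c<t (n<1+n _)) t<top
    ... | _ , q∈R , _ , h | _ , q′∈R , _ , h′ =
      trans h (trans (cong suc (trans (All.lookup inRow q∈R) (sym (All.lookup inRow q′∈R)))) (sym h′))

    vertical⇒beads : Vertical R → AllBeads (config μ) c (c + ℓ)
    vertical⇒beads (y₀ , inCol) {t} (c<t , t<top)
      with covers c<t (<⇒≤ t<top) | covers (<-trans c<t (n<1+n _)) t<top
    ... | (x , y) , q∈R , e , h | (x′ , y′) , q′∈R , e′ , h′ =
      trans h (cong suc (trans x≡1+x′ (sym h′)))
      where
      open ≡-Reasoning
      x≡1+x′ : x ≡ suc x′
      x≡1+x′ = +-cancelˡ-≡ t x (suc x′) (begin
        t + x        ≡⟨ e ⟩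
        y + N        ≡⟨ cong (_+ N) (trans (All.lookup inCol q∈R) (sym (All.lookup inCol q′∈R))) ⟩
        y′ + N       ≡⟨ e′ ⟨
        suc t + x′   ≡⟨ +-suc t x′ ⟨
        t + suc x′   ∎)

    private
      offset : ∀ {p} → c < p → p ≤ c + ℓ → ∃[ k ] k < ℓ × suc c + k ≡ p
      offset c<p p≤top with m≤n⇒∃[o]m+o≡n c<p
      ... | k , refl = k , +-cancelˡ-≤ c _ _ (≤-trans (≤-reflexive (+-suc c k)) p≤top) , refl

      within : ∀ {k} → suc k < ℓ → Between c (c + ℓ) (suc c + k)
      within {k} k<ℓ = s≤s (m≤m+n c k) , ≤-trans
        (≤-reflexive (trans (cong suc (sym (+-suc c k))) (sym (+-suc c (suc k))))) (+-monoʳ-≤ c k<ℓ)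

    gaps⇒horizontal : AllGaps (config μ) c (c + ℓ) → Horizontal R
    gaps⇒horizontal gaps = pred (height μ (suc c)) , All.tabulate inRow
      where
      constant : ∀ k → k < ℓ → height μ (suc c + k) ≡ height μ (suc c)
      constant zero    _ = cong (height μ) (+-identityʳ (suc c))
      constant (suc k) k<ℓ = trans (cong (height μ) (+-suc (suc c) k))
        (trans (sym (gaps (within k<ℓ))) (constant k (<-trans (n<1+n k) k<ℓ)))
      inRow : ∀ {q} → q ∈ boxes R → proj₁ q ≡ pred (height μ (suc c))
      inRow q∈R with onRim q∈R
      ... | p , c<p , p≤top , _ , h with offset c<p p≤top
      ...   | k , k<ℓ , refl = cong pred (trans (sym h) (constant k k<ℓ))

    -- Along beads the height falls by one whenever the index grows by one. Their sum, which
    -- determines the column, stays fixed.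
    beads⇒vertical : AllBeads (config μ) c (c + ℓ) → Vertical R
    beads⇒vertical beads = c + height μ (suc c) ∸ N , All.tabulate inCol
      where
      constant : ∀ k → k < ℓ → k + height μ (suc c + k) ≡ height μ (suc c)
      constant zero    _ = cong (height μ) (+-identityʳ (suc c))
      constant (suc k) k<ℓ = begin
        suc k + height μ (suc c + suc k)     ≡⟨ cong (λ t → suc k + height μ t) (+-suc (suc c) k) ⟩
        suc k + height μ (suc (suc c + k))   ≡⟨ +-suc k _ ⟨
        k + suc (height μ (suc (suc c + k))) ≡⟨ cong (k +_) (beads (within k<ℓ)) ⟨
        k + height μ (suc c + k)             ≡⟨ constant k (<-trans (n<1+n k) k<ℓ) ⟩
        height μ (suc c)                     ∎
        where open ≡-Reasoning
      inCol : ∀ {q} → q ∈ boxes R → proj₂ q ≡ c + height μ (suc c) ∸ N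
      inCol {x , y} q∈R with onRim q∈R
      ... | p , c<p , p≤top , e , h with offset c<p p≤top
      ...   | k , k<ℓ , refl = begin
        y                               ≡⟨ m+n∸n≡m y N ⟨
        y + N ∸ N                       ≡⟨ cong (_∸ N) e ⟨
        suc c + k + x ∸ N               ≡⟨ cong (_∸ N) (rearrange c k x) ⟩
        c + (k + suc x) ∸ N             ≡⟨ cong (λ h → c + (k + h) ∸ N) h ⟨
        c + (k + height μ (suc c + k)) ∸ N ≡⟨ cong (λ h → c + h ∸ N) (constant k k<ℓ) ⟩
        c + height μ (suc c) ∸ N        ∎
        where
        open ≡-Reasoning
        rearrange : ∀ c k x → suc c + k + x ≡ c + (k + suc x)
        rearrange = solve-∀

  shareEdge-sym : ∀ {q q′} → ShareEdge q q′ → ShareEdge q′ q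
  shareEdge-sym right = left
  shareEdge-sym left  = right
  shareEdge-sym below = above
  shareEdge-sym above = below

  adjacent⇒near : ∀ {μ} (R : RimHook ℓ μ) (S : RimHook ℓ (remaining R)) {c d} →
    Spans μ (boxes R) c → Spans (remaining R) (boxes S) d → AdjacentHooks R S →
    ¬ c + ℓ < d × ¬ d + ℓ < c
  adjacent⇒near R S R-spans S-spans (q , q′ , q∈R , q′∈S , edge)
    with Spans.onRim R-spans q∈R | Spans.onRim S-spans q′∈S
  ... | p , c<p , p≤ , e , _ | p′ , d<p′ , p′≤ , e′ , _ =
      (λ c+ℓ<d → <⇒≱ (≤-<-trans (≤-trans (s≤s p≤) c+ℓ<d) d<p′) (shareEdge-index edge e e′))
    , (λ d+ℓ<c → <⇒≱ (≤-<-trans (≤-trans (s≤s p′≤) d+ℓ<c) c<p) (shareEdge-index (shareEdge-sym edge) e′ e))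

  -- One hook is removed before the other, so they lie on rims of different partitions. `κ` agrees
  -- in height with each where it matters, which puts both boxes on a single rim.
  consecutive⇒adjacent : ∀ κ {μ ν bs bs′ c d p} → Spans μ bs c → Spans ν bs′ d →
    c < p → p ≤ c + ℓ → d < suc p → suc p ≤ d + ℓ →
    height κ p ≡ height μ p → height κ (suc p) ≡ height ν (suc p) →
    ∃[ q ] ∃[ q′ ] q ∈ bs × q′ ∈ bs′ × ShareEdge q q′
  consecutive⇒adjacent κ spans spans′ c<p p≤ d<p p<d+ℓ μ-eq ν-eq =
    let q , q∈ , e , h = Spans.covers spans c<p p≤
        q′ , q′∈ , e′ , h′ = Spans.covers spans′ d<p p<d+ℓ
    in q , q′ , q∈ , q′∈ , rimAt-adjacent κ (e , trans μ-eq h) (e′ , trans ν-eq h′)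

  -- The rim hook belonging to a gap `c` and a bead `c + ℓ`.

  module _ (μ : Partition) (fits : Fits μ) {c : ℕ} (gap-c : Gap μ c) (bead-top : Bead μ (c + ℓ)) where
    private
      box : ℕ → Box
      box i = rimBox μ (suc c + i)

      rim : List Box
      rim = applyUpTo box ℓ

      height-pos : ∀ {p} → p ≤ c + ℓ → 0 < height μ p
      height-pos p≤ = <-≤-trans (subst (0 <_) (sym bead-top) z<s) (antitone (height-suc≤ μ) p≤)

      -- Index plus height never decreases along the boundary, and the gap at `c` makes it exceed
      -- `N` from `suc c` on. So the last counted place of each diagonal in the window is a genuine
      -- box and not left of the diagram.
      N<index : ∀ k → N < suc c + k + height μ (suc c + k)
      N<index zero = s≤s (≤-trans (N≤p+height μ fits c)
        (+-mono-≤ (≤-reflexive (sym (+-identityʳ c)))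
          (≤-reflexive (trans gap-c (cong (height μ) (sym (+-identityʳ (suc c))))))))
      N<index (suc k) = begin
        suc N                                      ≤⟨ N<index k ⟩
        suc c + k + height μ (suc c + k)           ≤⟨ +-monoʳ-≤ (suc c + k) (height≤suc μ (suc c + k)) ⟩
        suc c + k + suc (height μ (suc (suc c + k))) ≡⟨ +-suc (suc c + k) _ ⟩
        suc (suc c + k) + height μ (suc (suc c + k)) ≡⟨ cong (λ p → p + height μ p) (+-suc (suc c) k) ⟨
        suc c + suc k + height μ (suc c + suc k)   ∎
        where open ≤-Reasoning

      suc-pred-height : ∀ {p} → p ≤ c + ℓ → height μ p ≡ suc (pred (height μ p))
      suc-pred-height p≤ = sym (suc-pred _ {{>-nonZero (height-pos p≤)}})

      box-top : ∀ {i} → i < ℓ → suc c + i ≤ c + ℓ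
      box-top {i} i<ℓ = ≤-trans (≤-reflexive (sym (+-suc c i))) (+-monoʳ-≤ c i<ℓ)

      box-rimAt : ∀ {i} → i < ℓ → RimAt μ (suc c + i) (box i)
      box-rimAt {i} i<ℓ = sym (m∸n+n≡m N≤) , h
        where
        h = suc-pred-height (box-top i<ℓ)
        N≤ : N ≤ suc c + i + pred (height μ (suc c + i))
        N≤ = s≤s⁻¹ (≤-trans (N<index i) (≤-reflexive (trans (cong (suc c + i +_) h) (+-suc (suc c + i) _))))

      ∈rim⁻ : ∀ {q} → q ∈ rim → ∃[ p ] c < p × p ≤ c + ℓ × RimAt μ p q
      ∈rim⁻ q∈ with ∈-applyUpTo⁻ box q∈
      ... | i , i<ℓ , refl = suc c + i , s≤s (m≤m+n c i) , box-top i<ℓ , box-rimAt i<ℓ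

      ∈rim⁺ : ∀ {p q} → c < p → p ≤ c + ℓ → RimAt μ p q → q ∈ rim
      ∈rim⁺ {p} c<p p≤ at with m≤n⇒∃[o]m+o≡n c<p
      ... | i , refl = subst (_∈ rim) (rimBox-unique μ at)
        (∈-applyUpTo⁺ box (+-cancelˡ-≤ c _ _ (≤-trans (≤-reflexive (+-suc c i)) p≤)))

      rim-inside : ∀ {q} → q ∈ rim → q ∈Y μ
      rim-inside q∈ with ∈rim⁻ q∈
      ... | p , _ , _ , e , h = <height⇒∈Y μ fits e (≤-reflexive (sym h))

      rim-unique : Unique rim
      rim-unique = Unique.applyUpTo⁺₁ box ℓ λ {i} {j} i<j j<ℓ eq → <⇒≢ i<j (+-cancelˡ-≡ (suc c) i j
        (rimAt-index μ (box-rimAt (<-trans i<j j<ℓ)) (subst (RimAt μ (suc c + j)) (sym eq) (box-rimAt j<ℓ))))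

      rim-no2×2 : ¬ Contains2×2 rim
      rim-no2×2 (x , y , q∈ , _ , _ , q′∈) with ∈rim⁻ q∈ | ∈rim⁻ q′∈
      ... | p , _ , _ , e , h | p′ , _ , _ , e′ , h′
        with +-cancelʳ-≡ (suc x) p p′ (trans (+-suc p x) (trans (cong suc e) (sym e′)))
      ...   | refl = 1+n≢n (suc-injective (trans (sym h′) h))

      rim-path : ∀ i k → i + k < ℓ → Star (StepIn rim) (box i) (box (i + k))
      rim-path i zero    _   = subst (λ j → Star (StepIn rim) (box i) (box j)) (sym (+-identityʳ i)) ε
      rim-path i (suc k) i+k<ℓ = (∈-applyUpTo⁺ box i<ℓ , ∈-applyUpTo⁺ box si<ℓ , edge)
        ◅ subst (λ j → Star (StepIn rim) (box (suc i)) (box j)) (sym (+-suc i k)) (rim-path (suc i) k si+k<ℓ)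
        where
        si+k<ℓ : suc i + k < ℓ
        si+k<ℓ = ≤-<-trans (≤-reflexive (sym (+-suc i k))) i+k<ℓ
        si<ℓ = ≤-<-trans (m≤m+n (suc i) k) si+k<ℓ
        i<ℓ = <-trans (n<1+n i) si<ℓ
        edge : ShareEdge (box i) (box (suc i))
        edge = rimAt-adjacent μ (box-rimAt i<ℓ)
          (subst (λ p → RimAt μ p (box (suc i))) (+-suc (suc c) i) (box-rimAt si<ℓ))

      rim-connected : Connected rim
      rim-connected q∈ q′∈ with ∈-applyUpTo⁻ box q∈ | ∈-applyUpTo⁻ box q′∈
      ... | i , i<ℓ , refl | j , j<ℓ , refl with ≤-total i j
      ...   | inj₁ i≤j with m≤n⇒∃[o]m+o≡n i≤j
      ...     | k , refl = rim-path i k j<ℓ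
      rim-connected q∈ q′∈ | i , i<ℓ , refl | j , j<ℓ , refl | inj₂ j≤i with m≤n⇒∃[o]m+o≡n j≤i
      ...     | k , refl = Star.reverse (λ (a , b , e) → b , a , shareEdge-sym e) (rim-path j k i<ℓ)

      InRest : ℕ → ℕ → Set
      InRest x y = (x , y) ∈Y μ × (x , y) ∉ rim

      -- The right neighbour in `μ` of a rim box is itself the rim box of the next diagonal. It
      -- could survive only beyond index `c + ℓ`, but the bead there says that the row has ended.
      rest-left : ∀ {x y} → InRest x (suc y) → InRest x y
      rest-left {x} {y} (q∈ , q∉) = <-trans (n<1+n y) q∈ , λ q′∈ → case ∈rim⁻ q′∈ of λ
        { (p , c<p , p≤ , e , h) →
          let e′ = cong suc e
              h′ = ≤-antisym (≤-trans (height-suc≤ μ p) (≤-reflexive h)) (∈Y⇒<height μ fits e′ q∈)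
          in case m≤n⇒m<n∨m≡n p≤ of λ
            { (inj₁ p<) → q∉ (∈rim⁺ (<-trans c<p (n<1+n p)) p< (e′ , h′))
            ; (inj₂ refl) → bead∧gap⇒⊥ μ bead-top (trans h (sym h′)) } }

      -- Likewise at the other end: a survivor below a removed box would lie on diagonal `c`, where
      -- the gap says that the column has ended.
      rest-up : ∀ {x y} → InRest (suc x) y → InRest x y
      rest-up {x} {y} (q∈ , q∉) = ∈Y-closed μ (n≤1+n x) ≤-refl q∈ , λ q′∈ → case ∈rim⁻ q′∈ of λ
        { (suc p , s≤s c≤p , p≤ , e , h) →
          let e′ = trans (+-suc p x) e
              h′ = ≤-antisym (≤-trans (height≤suc μ p) (≤-reflexive (cong suc h))) (∈Y⇒<height μ fits e′ q∈)
          in case m≤n⇒m<n∨m≡n c≤p of λ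
            { (inj₁ c<p) → q∉ (∈rim⁺ c<p (≤-trans (n≤1+n p) p≤) (e′ , h′))
            ; (inj₂ refl) → bead∧gap⇒⊥ μ (trans h′ (cong suc (sym h))) gap-c } }

      inRest? : ∀ x y → Dec (InRest x y)
      inRest? x y = (y <? rowLength μ x) ×-dec ¬? ((x , y) ∈? rim)

      restRow : ℕ → ℕ
      restRow x = threshold (inRest? x) (rowLength μ x)

      restRow-suc≤ : ∀ x → restRow (suc x) ≤ restRow x
      restRow-suc≤ x = <⇒≤-pointwise λ y< →
        let _ , r = threshold⁻ (inRest? (suc x)) (rowLength μ (suc x)) y<
            r′ = rest-up r
        in threshold⁺ (inRest? x) rest-left (proj₁ r′) r′

      rest : Partition
      rest = fromRows restRow restRow-suc≤ N

      restRow-beyond : restRow N ≡ 0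
      restRow-beyond = n<1⇒n≡0 (≰⇒> λ 0< → <-irrefl refl
        (fits (proj₁ (proj₂ (threshold⁻ (inRest? N) (rowLength μ N) 0<)))))

      rest⇔ : ∀ q → q ∈Y rest ⇔ (q ∈Y μ × q ∉ rim)
      rest⇔ (x , y) = mk⇔
        (λ y< → proj₂ (threshold⁻ (inRest? x) (rowLength μ x) (subst (y <_) rest-row y<)))
        (λ r → subst (y <_) (sym rest-row) (threshold⁺ (inRest? x) rest-left (proj₁ r) r))
        where
        rest-row : rowLength rest x ≡ restRow x
        rest-row = rowLength-fromRows restRow restRow-suc≤ N restRow-beyond x

    rimHook : RimHook ℓ μ
    rimHook = record
      { boxes = rim ; unique = rim-unique ; size = length-applyUpTo box ℓ
      ; inside = All.tabulate rim-inside ; connected = rim-connected ; no2×2 = rim-no2×2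
      ; remaining = rest ; removal = rest⇔ }

    rimHook-spans : Spans μ (boxes rimHook) c
    rimHook-spans = record
      { onRim = ∈rim⁻
      ; covers = λ {p} c<p p≤ → case m≤n⇒∃[o]m+o≡n c<p of λ
          { (i , refl) → let i<ℓ = +-cancelˡ-≤ c _ _ (≤-trans (≤-reflexive (+-suc c i)) p≤)
                         in box i , ∈-applyUpTo⁺ box i<ℓ , box-rimAt i<ℓ } }

  -- The two implications.

  nonviolating⇒straight : ∀ {μ} → Fits μ → ¬ Violation (config μ) → OnlyStraightHooks ℓ μ
  nonviolating⇒straight {μ} fits ¬v R = go (hook-spans R fits)
    where
    go : ∃[ c ] Spans μ (boxes R) c → Horizontal R ⊎ Vertical R
    go (c , spans) = [ inj₂ ∘ beads⇒vertical R spans , inj₁ ∘ gaps⇒horizontal R spans ]′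
      (uniform {B = config μ} ¬v {c} {c + ℓ} refl (Moved.gap-p move) (Moved.bead-q move))
      where
      move : Moved c (c + ℓ) (config μ) (config (remaining R))
      move = hook-moved R fits spans

  nonviolating⇒¬adjacent : ∀ {μ} → Fits μ → ¬ Violation (config μ) → NoAdjacentMixedHooks ℓ μ
  nonviolating⇒¬adjacent {μ} fits ¬v R S mixed adjacent =
    go (hook-spans R fits) (hook-spans S (fits-remaining R fits))
    where
    ν = remaining R
    go : ∃[ c ] Spans μ (boxes R) c → ∃[ d ] Spans ν (boxes S) d → ⊥
    go (c , R-spans) (d , S-spans) = [
        (λ (R-vertical , S-horizontal) → ¬v (adjacent⇒violation refl R-moved refl S-moved
          (vertical⇒beads R R-spans R-vertical) (horizontal⇒gaps S S-spans S-horizontal) c+ℓ≮d d+ℓ≮c))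
      , (λ (R-horizontal , S-vertical) → ¬v (adjacent⇒violation′ {B = config μ} refl R-moved refl S-moved
          (horizontal⇒gaps R R-spans R-horizontal) (vertical⇒beads S S-spans S-vertical) c+ℓ≮d d+ℓ≮c))
      ]′ mixed
      where
      R-moved : Moved c (c + ℓ) (config μ) (config ν)
      R-moved = hook-moved R fits R-spans
      S-moved : Moved d (d + ℓ) (config ν) (config (remaining S))
      S-moved = hook-moved S (fits-remaining R fits) S-spans
      c+ℓ≮d = proj₁ (adjacent⇒near R S R-spans S-spans adjacent)
      d+ℓ≮c = proj₂ (adjacent⇒near R S R-spans S-spans adjacent)

  nonviolating-removal : ∀ {μ} (R : RimHook ℓ μ) → Fits μ → ¬ Violation (config μ) →
                         ¬ Violation (config (remaining R))
  nonviolating-removal R fits ¬v =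
    let c , spans = hook-spans R fits
    in ¬v ∘ violation⁻ {p = c} refl (hook-moved R fits spans)

  nonviolating⇒generalized : ∀ {μ} → Fits μ → ¬ Violation (config μ) → IsGeneralized ℓ μ
  nonviolating⇒generalized fits ¬v = record
    { onlyStraight    = nonviolating⇒straight fits ¬v
    ; noAdjacentMixed = nonviolating⇒¬adjacent fits ¬v
    ; afterRemovals   = after fits ¬v
    }
    where
    after : ∀ {μ} → Fits μ → ¬ Violation (config μ) → ∀ {ν} → Star (RemoveStraight ℓ) μ ν →
            OnlyStraightHooks ℓ ν × NoAdjacentMixedHooks ℓ ν
    after fits ¬v ε = nonviolating⇒straight fits ¬v , nonviolating⇒¬adjacent fits ¬v
    after fits ¬v (remove R _ ◅ rest) = after (fits-remaining R fits) (nonviolating-removal R fits ¬v) rest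

  generalized-removal : ∀ {μ} → IsGeneralized ℓ μ → (R : RimHook ℓ μ) → IsGeneralized ℓ (remaining R)
  generalized-removal gen R = record
    { onlyStraight    = proj₁ (afterRemovals (step ◅ ε))
    ; noAdjacentMixed = proj₂ (afterRemovals (step ◅ ε))
    ; afterRemovals   = λ steps → afterRemovals (step ◅ steps)
    }
    where
    open IsGeneralized gen
    step = remove R (onlyStraight R)

  -- Induction on the number of boxes. Each move is the removal of a rim hook; that hook is
  -- straight, so the remaining partition is generalized again and its lack of violations supplies
  -- `next`.
  generalized⇒nonviolating : ∀ {μ} → Acc _<_ (length (boxesOf μ)) → Fits μ →
                             IsGeneralized ℓ μ → ¬ Violation (config μ)
  generalized⇒nonviolating {μ} (acc smaller) fits gen = tame⇒¬violation tame
    where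
    open IsGeneralized gen

    0<ℓ : 0 < ℓ
    0<ℓ = ≤-trans (s≤s z≤n) ℓ≥3

    straight : ∀ {p q} → p + ℓ ≡ q → Gap μ p → Bead μ q →
               AllBeads (config μ) p q ⊎ AllGaps (config μ) p q
    straight {p} refl gap bead = go (onlyStraight R)
      where
      R = rimHook μ fits gap bead
      spans = rimHook-spans μ fits gap bead
      go : Horizontal R ⊎ Vertical R → AllBeads (config μ) p (p + ℓ) ⊎ AllGaps (config μ) p (p + ℓ)
      go (inj₁ horizontal) = inj₂ (horizontal⇒gaps R spans horizontal)
      go (inj₂ vertical)   = inj₁ (vertical⇒beads R spans vertical)

    -- Moving `q` down to `p` removes a vertical hook and frees `q`. Then `r` can move to `q`, which
    -- removes a horizontal hook starting on the diagonal right after the last one of the first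
    -- hook.
    ¬bead-step : ∀ {p q r} → p + ℓ ≡ q → q + ℓ ≡ r → Gap μ p → AllBeads (config μ) p q → Bead μ q →
                 AllGaps (config μ) q r → Bead μ r → ⊥
    ¬bead-step {p} {q} refl refl gap-p beads bead-q gaps bead-r =
      noAdjacentMixed R S (inj₁ (beads⇒vertical R R-spans beads , gaps⇒horizontal S S-spans gaps′))
        (consecutive⇒adjacent μ R-spans S-spans p<q ≤-refl ≤-refl q<r
          refl (sym (height-outside R fits R-spans (λ (_ , q<q) → <-irrefl refl q<q))))
      where
      R = rimHook μ fits gap-p bead-q
      R-spans = rimHook-spans μ fits gap-p bead-q
      ν = remaining R
      fits-ν = fits-remaining R fits
      open Moved (hook-moved R fits R-spans) using (gap-q′; bead′; gap′)
      q<r = m<m+n q 0<ℓ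
      p<q = m<m+n p 0<ℓ
      bead-r′ : Bead ν (q + ℓ)
      bead-r′ = bead′ bead-r (≺⇒≢ q<r ∘ sym)
      S = rimHook ν fits-ν gap-q′ bead-r′
      S-spans = rimHook-spans ν fits-ν gap-q′ bead-r′
      gaps′ : AllGaps (config ν) q (q + ℓ)
      gaps′ (q<t , t<r) = gap′ (gaps (q<t , t<r)) (≺⇒≢ (<-trans p<q q<t) ∘ sym)

    -- Here one bead makes both moves: from `r` to `q` by a horizontal hook, then from `q` to `p` by
    -- a vertical hook ending on the diagonal right before the first.
    ¬gap-step : ∀ {p q r} → p + ℓ ≡ q → q + ℓ ≡ r → Gap μ p → AllBeads (config μ) p q → Gap μ q →
                AllGaps (config μ) q r → Bead μ r → ⊥
    ¬gap-step {p} {q} refl refl gap-p beads gap-q gaps bead-r =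
      noAdjacentMixed R S (inj₂ (gaps⇒horizontal R R-spans gaps , beads⇒vertical S S-spans beads′))
        (let s , t , s∈ , t∈ , edge = consecutive⇒adjacent μ S-spans R-spans p<q ≤-refl ≤-refl q<r
               (sym (height-outside R fits R-spans (λ (q<q , _) → <-irrefl refl q<q))) refl
         in t , s , t∈ , s∈ , shareEdge-sym edge)
      where
      R = rimHook μ fits gap-q bead-r
      R-spans = rimHook-spans μ fits gap-q bead-r
      ν = remaining R
      fits-ν = fits-remaining R fits
      open Moved (hook-moved R fits R-spans) using (bead-p′; bead′; gap′)
      q<r = m<m+n q 0<ℓ
      p<q = m<m+n p 0<ℓ
      gap-p′ : Gap ν p
      gap-p′ = gap′ gap-p (≺⇒≢ p<q)
      S = rimHook ν fits-ν gap-p′ bead-p′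
      S-spans = rimHook-spans ν fits-ν gap-p′ bead-p′
      beads′ : AllBeads (config ν) p q
      beads′ (p<t , t<q) = bead′ (beads (p<t , t<q)) (≺⇒≢ (<-trans t<q q<r))

    next : ∀ {p q} → p + ℓ ≡ q → Gap μ p → Bead μ q → ∃[ B′ ] Moved p q (config μ) B′ × ¬ Violation B′
    next refl gap bead =
      let R = rimHook μ fits gap bead
      in config (remaining R) , hook-moved R fits (rimHook-spans μ fits gap bead)
         , generalized⇒nonviolating (smaller (size-remaining< R)) (fits-remaining R fits)
             (generalized-removal gen R)

    tame : Tame (config μ)
    tame = record { straight = straight ; ¬bead-step = ¬bead-step ; ¬gap-step = ¬gap-step ; next = next }

theorem3p2p2p7 : (ℓ : ℕ) → ℓ ≥ 3 → (μ : Partition) → IsJM ℓ μ ⇔ IsGeneralized ℓ μ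
theorem3p2p2p7 ℓ ℓ≥3 μ = mk⇔
  (λ jm → nonviolating⇒generalized fits (jm⇒¬violation μ fits jm))
  (λ gen → ¬violation⇒jm μ fits (generalized⇒nonviolating (<-wellFounded _) fits gen))
  where
  open RimHooks ℓ ℓ≥3 (length (parts μ))
  open Heights (length (parts μ))
  fits : Fits μ
  fits y<λ = nthPart-length (parts μ) (≤-<-trans z≤n y<λ)
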